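{- Let $r,p,s,n$ be positive integers such that $p\mid r$, $s\mid r$ and $ps\mid rn$. Then, as formal power series in $t,q,a$, $$\Bigg\{\sum_{k\geq 0}t^k\left([k+1]_{q^{r/s}}+aq\,[k]_{q^{r/s}}\Big[\frac{r}{s}-1\Big]_{aq}\right)^n\Bigg\}_{q^p}=\frac{\sum_{g\in G(r,p,s,n)}t^{\mathrm{des}(g)}q^{\mathrm{fmaj}(g)}a^{\mathrm{col}(g)}}{(1-t)(1-t^sq^r)(1-t^sq^{2r})\cdots(1-t^sq^{(n-1)r})(1-tq^{nr/s})}.$$
   Context: Notation. For a positive integer $m$, $R_m(i)\in\{0,\ldots,m-1\}$ denotes the residue of $i\in\mathbb Z$ modulo $m$. $[m]_x=1+x+\cdots+x^{m-1}$, with $[0]_x=0$. For a power series $F$, $\{F\}_{q^p}$ is obtained from $F$ by discarding all terms whose degree in $q$ is not divisible by $p$. Groups. $G(r,n)$ is the group of pairs $(c_1,\ldots,c_n;\sigma)$ with $c_i\in\{0,\ldots,r-1\}$ (the colors) and $\sigma\in S_n$, with product $(d_1,\ldots,d_n;\tau)(c_1,\ldots,c_n;\sigma)=(R_r(c_1+d_{\sigma(1)}),\ldots,R_r(c_n+d_{\sigma(n)});\tau\sigma)$. For $p\mid r$, $G(r,p,n)$ is the subgroup of elements with $c_1+\cdots+c_n\equiv 0 \bmod p$. For $s\mid r$ with $ps\mid rn$, $C_s\subseteq G(r,p,n)$ is the cyclic subgroup of order $s$ generated by $(r/s,\ldots,r/s;\mathrm{id})$, and $G(r,p,s,n)=G(r,p,n)/C_s$.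 Statistics. For $g\in G(r,p,s,n)$ represented by $(c_1,\ldots,c_n;\sigma)$ let $\mathrm{HDes}(g)=\{i\in\{1,\ldots,n-1\}: c_i=c_{i+1},\ \sigma(i)>\sigma(i+1)\}$, $h_i(g)=\#\{j\ge i: j\in\mathrm{HDes}(g)\}$, $k_n(g)=R_{r/s}(c_n)$, $k_i(g)=k_{i+1}(g)+R_r(c_i-c_{i+1})$ for $1\le i\le n-1$, $\lambda_i(g)=r\,h_i(g)+k_i(g)$. Then $\mathrm{fmaj}(g)=\sum_{i=1}^n\lambda_i(g)$, $\mathrm{des}(g)=\left\lfloor\frac{s\lambda_1(g)+r-s}{r}\right\rfloor$, $\mathrm{col}(g)=\sum_{i=1}^nR_{r/s}(c_i)$. These do not depend on the representative chosen. -}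

module Defs where

open import Level using (Level; 0ℓ)
open import Algebra.Bundles using (RawRing; Ring; Group)
open import Algebra.Structures using (IsGroup)
import Algebra.Definitions.RawSemiring as RawSemiringOps
import Algebra.Properties.Monoid.Mult as Mult
open import Data.Bool.Base using (if_then_else_)
open import Data.Nat.Base as ℕ using (ℕ; zero; suc; NonZero; _∸_; _/_; _%_)
import Data.Nat.Properties as ℕₚ
open import Data.Nat.DivMod using
  ( _mod_; m%n<n; m<n⇒m%n≡m; m%n%n≡m%n; %-distribˡ-+; n%n≡0; m*n%n≡0; m≡m%n+[m/n]*n
  ; [m+kn]%n≡m%n; m/n*n≡m; m*[n/m]≡n; m≥n⇒m/n>0 )
open import Data.Nat.Divisibility using (_∣_; _∣?_; ∣⇒≤)
open import Data.Integer.Base as ℤ using (ℤ; _%ℕ_)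
open import Data.Fin.Base as Fin using (Fin; zero; suc; toℕ; punchIn)
import Data.Fin.Properties as Finₚ
open import Data.Fin.Permutation as Perm using (Permutation′; _⟨$⟩ʳ_; _⟨$⟩ˡ_; _∘ₚ_)
open import Data.Vec.Functional as Vector using (Vector)
open import Data.List.Base as List
  using (List; []; _∷_; length; filter; allFin; cartesianProductWith; mapMaybe; deduplicate)
import Data.List.Relation.Unary.Any.Properties as Anyₚ
open import Data.List.Relation.Unary.Any using (Any; here; there)
open import Data.List.Relation.Unary.Enumerates.Setoid using (IsEnumeration)
import Data.List.Relation.Unary.Enumerates.Setoid.Properties as Enumerates
open import Data.List.Relation.Unary.Unique.Setoid using (Unique)
import Data.List.Relation.Unary.Unique.DecSetoid.Properties as UniqueDec
open import Data.List.Membership.Propositional.Properties using (∈-allFin)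
open import Data.Maybe.Base using (Maybe; just; nothing)
open import Data.Product.Base using (∃; Σ-syntax; _×_; _,_; proj₁; proj₂)
open import Function.Base using (_∘_)
open import Relation.Binary.Bundles using (DecSetoid)
open import Relation.Binary.Core using (Rel)
open import Relation.Binary.Definitions using (Decidable)
open import Relation.Binary.PropositionalEquality
  using (_≡_; refl; sym; trans; cong; cong₂; subst; module ≡-Reasoning)
open import Relation.Nullary using (Dec; yes; no; does; contradiction)
open import Relation.Nullary.Decidable using (map′; _×-dec_)

private
  variable
    c ℓ : Level

module RingOps (R : RawRing c ℓ) where
  open RawRing R public
  open RawSemiringOps rawSemiring public using (_^_; sum; product)

  infixl 6 _-_
  _-_ : Carrier → Carrier → Carrier
  x - y = x + (- y)

  [_]_ : ℕ → Carrier → Carrier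
  [ m ] x = sum {m} (λ i → x ^ toℕ i)

  infix 8 [_]_

-- Formal power series in one variable, as coefficient sequences.  Several
-- variables are obtained by iterating the construction.

module PowerSeries (R : RawRing c ℓ) where
  open RingOps R

  Series : Set c
  Series = ℕ → Carrier

  const : Carrier → Series
  const x zero    = x
  const x (suc _) = 0#

  var : Series
  var (suc zero) = 1#
  var _          = 0#

  _⊗_ : Series → Series → Series
  (f ⊗ g) n = sum {suc n} (λ i → f (toℕ i) * g (n ∸ toℕ i))

  rawRing : RawRing c ℓ
  rawRing = record
    { Carrier = Series
    ; _≈_     = λ f g → ∀ n → f n ≈ g n
    ; _+_     = λ f g n → f n + g n
    ; _*_     = _⊗_
    ; -_      = λ f n → - f n
    ; 0#      = λ _ → 0#
    ; 1#      = const 1#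
    }

  -- The multiplicative inverse g of a series f whose constant coefficient is
  -- 1, determined by g₀ = 1 and gₙ = - (f₁ gₙ₋₁ + ⋯ + fₙ g₀).  (The value is
  -- meaningless for other f.)
  -- inverseCoeffs f n = (gₙ₋₁ , … , g₀).
  nextCoeff : Series → (n : ℕ) → Vector Carrier n → Carrier
  nextCoeff f zero    _ = 1#
  nextCoeff f (suc n) v = - sum (λ i → f (suc (toℕ i)) * v i)

  inverseCoeffs : Series → (n : ℕ) → Vector Carrier n
  inverseCoeffs f zero    = Vector.[]
  inverseCoeffs f (suc n) = nextCoeff f n (inverseCoeffs f n) Vector.∷ inverseCoeffs f n

  inverse : Series → Series
  inverse f n = nextCoeff f n (inverseCoeffs f n)

  infixl 7 _÷_
  _÷_ : Series → Series → Series
  f ÷ g = f ⊗ inverse g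

module _ (R : Ring c ℓ) where
  open Ring R using (rawRing; Carrier; _≈_; 1#; +-cong; *-congˡ)
  private
    module R = Ring R
    module P = PowerSeries rawRing
    open RingOps rawRing using (sum)

    sum-cong : ∀ {n} {u v : Vector Carrier n} → (∀ i → u i ≈ v i) → sum u ≈ sum v
    sum-cong {zero}  _  = R.refl
    sum-cong {suc n} eq = +-cong (eq zero) (sum-cong (eq ∘ suc))

    inverseCoeffs-at : ∀ f n (i : Fin n) →
      P.inverse f (n ∸ suc (toℕ i)) ≡ P.inverseCoeffs f n i
    inverseCoeffs-at f (suc n) zero    = refl
    inverseCoeffs-at f (suc n) (suc i) = inverseCoeffs-at f n i

  inverse-correct : ∀ f → f 0 ≈ 1# →
    RawRing._≈_ P.rawRing (f P.⊗ P.inverse f) (RawRing.1# P.rawRing)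
  inverse-correct f f₀≈1 zero =
    R.trans (R.+-identityʳ _) (R.trans (R.*-identityʳ _) f₀≈1)
  inverse-correct f f₀≈1 (suc n) =
    R.trans (+-cong (R.trans (R.*-congʳ f₀≈1) (R.*-identityˡ _))
                    (sum-cong λ i → *-congˡ {f (suc (toℕ i))} (R.reflexive (inverseCoeffs-at f (suc n) i))))
            (R.-‿inverseˡ _)

-- ℤ[[t,q,a]] as ℤ[[a]][[q]][[t]]: the coefficient of tⁱ qʲ aˡ in F is F i j l.

ℤ⟦a⟧ ℤ⟦q,a⟧ ℤ⟦t,q,a⟧ : RawRing 0ℓ 0ℓ
ℤ⟦a⟧     = PowerSeries.rawRing ℤ.+-*-rawRing
ℤ⟦q,a⟧   = PowerSeries.rawRing ℤ⟦a⟧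
ℤ⟦t,q,a⟧ = PowerSeries.rawRing ℤ⟦q,a⟧

-- A family of series F k not involving t is literally the list of
-- coefficients of ∑ₖ tᵏ F k.
∑ₖtᵏ : (ℕ → RawRing.Carrier ℤ⟦q,a⟧) → RawRing.Carrier ℤ⟦t,q,a⟧
∑ₖtᵏ F = F

-- { F } qᵖ, written keepQ p F.
keepQ : ℕ → RawRing.Carrier ℤ⟦t,q,a⟧ → RawRing.Carrier ℤ⟦t,q,a⟧
keepQ p F i j l = if does (p ∣? j) then F i j l else ℤ.0ℤ

-- Residue m i is R_m(i).
Residue : (m : ℕ) .{{_ : NonZero m}} → ℤ → ℕ
Residue m i = i %ℕ m

module _ {r : ℕ} .{{_ : NonZero r}} where
  infixl 6 _⊕_

  _⊕_ : Fin r → Fin r → Fin r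
  x ⊕ y = (toℕ x ℕ.+ toℕ y) mod r

  ⊖_ : Fin r → Fin r
  ⊖ x = (r ∸ toℕ x) mod r

  0ᵣ : Fin r
  0ᵣ = 0 mod r

  toℕ-mod : ∀ m → toℕ (m mod r) ≡ m % r
  toℕ-mod m = Finₚ.toℕ-fromℕ< (m%n<n m r)

  mod-cong : ∀ m n → m % r ≡ n % r → m mod r ≡ n mod r
  mod-cong m n eq = Finₚ.toℕ-injective (trans (toℕ-mod m) (trans eq (sym (toℕ-mod n))))

  private
    toℕ-% : (x : Fin r) → toℕ x % r ≡ toℕ x
    toℕ-% x = m<n⇒m%n≡m (Finₚ.toℕ<n x)

    mod-toℕ : (x : Fin r) → toℕ x mod r ≡ x
    mod-toℕ x = Finₚ.toℕ-injective (trans (toℕ-mod (toℕ x)) (toℕ-% x))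

    %-absorbˡ : ∀ m n → (m % r ℕ.+ n) % r ≡ (m ℕ.+ n) % r
    %-absorbˡ m n = trans (%-distribˡ-+ (m % r) n r)
      (trans (cong (λ z → (z ℕ.+ n % r) % r) (m%n%n≡m%n m r)) (sym (%-distribˡ-+ m n r)))

    %-absorbʳ : ∀ m n → (m ℕ.+ n % r) % r ≡ (m ℕ.+ n) % r
    %-absorbʳ m n = trans (cong (_% r) (ℕₚ.+-comm m (n % r)))
      (trans (%-absorbˡ n m) (cong (_% r) (ℕₚ.+-comm n m)))

  ⊕-mod : ∀ m n → m mod r ⊕ n mod r ≡ (m ℕ.+ n) mod r
  ⊕-mod m n = mod-cong _ (m ℕ.+ n)
    (trans (cong₂ (λ u v → (u ℕ.+ v) % r) (toℕ-mod m) (toℕ-mod n)) (sym (%-distribˡ-+ m n r)))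

  ⊕-assoc : ∀ x y z → (x ⊕ y) ⊕ z ≡ x ⊕ (y ⊕ z)
  ⊕-assoc x y z = mod-cong _ _ (begin
    (toℕ (x ⊕ y) ℕ.+ toℕ z) % r           ≡⟨ cong (λ u → (u ℕ.+ toℕ z) % r) (toℕ-mod _) ⟩
    ((toℕ x ℕ.+ toℕ y) % r ℕ.+ toℕ z) % r ≡⟨ %-absorbˡ _ (toℕ z) ⟩
    (toℕ x ℕ.+ toℕ y ℕ.+ toℕ z) % r       ≡⟨ cong (_% r) (ℕₚ.+-assoc (toℕ x) _ _) ⟩
    (toℕ x ℕ.+ (toℕ y ℕ.+ toℕ z)) % r     ≡⟨ %-absorbʳ (toℕ x) _ ⟨
    (toℕ x ℕ.+ (toℕ y ℕ.+ toℕ z) % r) % r ≡⟨ cong (λ u → (toℕ x ℕ.+ u) % r) (toℕ-mod _) ⟨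
    (toℕ x ℕ.+ toℕ (y ⊕ z)) % r           ∎)
    where open ≡-Reasoning

  ⊕-comm : ∀ x y → x ⊕ y ≡ y ⊕ x
  ⊕-comm x y = cong (_mod r) (ℕₚ.+-comm (toℕ x) (toℕ y))

  ⊕-identityˡ : ∀ x → 0ᵣ ⊕ x ≡ x
  ⊕-identityˡ x = trans
    (mod-cong _ _ (trans (cong (λ u → (u ℕ.+ toℕ x) % r) (toℕ-mod 0)) (%-absorbˡ 0 (toℕ x))))
    (mod-toℕ x)

  ⊕-identityʳ : ∀ x → x ⊕ 0ᵣ ≡ x
  ⊕-identityʳ x = trans (⊕-comm x 0ᵣ) (⊕-identityˡ x)

  ⊕-inverseˡ : ∀ x → ⊖ x ⊕ x ≡ 0ᵣ
  ⊕-inverseˡ x = mod-cong _ 0 (begin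
    (toℕ (⊖ x) ℕ.+ toℕ x) % r        ≡⟨ cong (λ u → (u ℕ.+ toℕ x) % r) (toℕ-mod _) ⟩
    ((r ∸ toℕ x) % r ℕ.+ toℕ x) % r  ≡⟨ %-absorbˡ (r ∸ toℕ x) (toℕ x) ⟩
    (r ∸ toℕ x ℕ.+ toℕ x) % r        ≡⟨ cong (_% r) (ℕₚ.m∸n+n≡m (ℕₚ.<⇒≤ (Finₚ.toℕ<n x))) ⟩
    r % r                            ≡⟨ n%n≡0 r ⟩
    0                                ≡⟨ m*n%n≡0 0 r ⟨
    0 % r                            ∎)
    where open ≡-Reasoning

  ⊕-inverseʳ : ∀ x → x ⊕ ⊖ x ≡ 0ᵣ
  ⊕-inverseʳ x = trans (⊕-comm x (⊖ x)) (⊕-inverseˡ x)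

record ColouredPerm (r n : ℕ) : Set where
  constructor _⨾_
  field
    colour : Vector (Fin r) n
    perm   : Permutation′ n

open ColouredPerm public

module _ {r n : ℕ} where
  infix 4 _≋_ _≋?_

  record _≋_ (g h : ColouredPerm r n) : Set where
    constructor _,_
    field
      colour-≡ : ∀ i → colour g i ≡ colour h i
      perm-≈   : perm g Perm.≈ perm h

  _≋?_ : Decidable _≋_
  g ≋? h = map′ (λ (c≡ , π≈) → c≡ , π≈) (λ (c≡ , π≈) → c≡ , π≈)
    (Finₚ.all? (λ i → colour g i Finₚ.≟ colour h i)
      ×-dec Finₚ.all? (λ i → (perm g ⟨$⟩ʳ i) Finₚ.≟ (perm h ⟨$⟩ʳ i)))

  module _ .{{_ : NonZero r}} where
    infixl 7 _∙_

    -- perm h ∘ₚ perm g is "first perm h, then perm g".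
    _∙_ : ColouredPerm r n → ColouredPerm r n → ColouredPerm r n
    g ∙ h = (λ i → colour h i ⊕ colour g (perm h ⟨$⟩ʳ i)) ⨾ (perm h ∘ₚ perm g)

    ε : ColouredPerm r n
    ε = (λ _ → 0ᵣ) ⨾ Perm.id

    infix 8 _⁻¹
    _⁻¹ : ColouredPerm r n → ColouredPerm r n
    g ⁻¹ = (λ i → ⊖ colour g (perm g ⟨$⟩ˡ i)) ⨾ Perm.flip (perm g)

    private
      ⁻¹-cong : ∀ {g h} → g ≋ h → g ⁻¹ ≋ h ⁻¹
      ⁻¹-cong {g} {h} (c≡ , π≈) = (λ i → cong ⊖_ (trans (c≡ _) (cong (colour h) (flip-≈ i)))) , flip-≈
        where
        flip-≈ : ∀ i → perm g ⟨$⟩ˡ i ≡ perm h ⟨$⟩ˡ i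
        flip-≈ i = trans (sym (Perm.inverseˡ (perm h)))
          (cong (perm h ⟨$⟩ˡ_) (trans (sym (π≈ _)) (Perm.inverseʳ (perm g))))

      isGroup : IsGroup _≋_ _∙_ ε _⁻¹
      isGroup = record
        { isMonoid = record
          { isSemigroup = record
            { isMagma = record
              { isEquivalence = record
                { refl  = (λ _ → refl) , (λ _ → refl)
                ; sym   = λ (c≡ , π≈) → (λ i → sym (c≡ i)) , (λ i → sym (π≈ i))
                ; trans = λ (c≡ , π≈) (c≡′ , π≈′) →
                    (λ i → trans (c≡ i) (c≡′ i)) , (λ i → trans (π≈ i) (π≈′ i))
                }
              ; ∙-cong = λ {g} {g′} {h} {h′} (c≡ , π≈) (d≡ , τ≈) →
                  (λ i → cong₂ _⊕_ (d≡ i) (trans (c≡ _) (cong (colour g′) (τ≈ i)))) ,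
                  (λ i → trans (π≈ _) (cong (perm g′ ⟨$⟩ʳ_) (τ≈ i)))
              }
            ; assoc = λ g h k → (λ i → sym (⊕-assoc (colour k i) _ _)) , (λ _ → refl)
            }
          ; identity = (λ g → (λ i → ⊕-identityʳ _) , (λ _ → refl))
                     , (λ g → (λ i → ⊕-identityˡ _) , (λ _ → refl))
          }
        ; inverse = (λ g → (λ i → trans (cong (λ j → colour g i ⊕ ⊖ colour g j) (Perm.inverseˡ (perm g)))
                                        (⊕-inverseʳ _))
                         , (λ i → Perm.inverseˡ (perm g)))
                  , (λ g → (λ i → ⊕-inverseˡ _) , (λ i → Perm.inverseʳ (perm g)))
        ; ⁻¹-cong = λ {g} {h} → ⁻¹-cong {g} {h}
        }

    G[_,_] : Group 0ℓ 0ℓ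
    G[_,_] = record { isGroup = isGroup }

allColourings : ∀ r n → List (Vector (Fin r) n)
allColourings r zero    = Vector.[] ∷ []
allColourings r (suc n) = cartesianProductWith Vector._∷_ (allFin r) (allColourings r n)

allPerms : ∀ n → List (Permutation′ n)
allPerms zero    = Perm.id ∷ []
allPerms (suc n) = cartesianProductWith (Perm.insert zero) (allFin (suc n)) (allPerms n)

allColouredPerms : ∀ r n → List (ColouredPerm r n)
allColouredPerms r n = cartesianProductWith _⨾_ (allColourings r n) (allPerms n)

private
  colourings-complete : ∀ r n (v : Vector (Fin r) n) →
    Any (λ w → ∀ i → v i ≡ w i) (allColourings r n)
  colourings-complete r zero    v = here (λ ())
  colourings-complete r (suc n) v = Anyₚ.cartesianProductWith⁺ Vector._∷_
    (λ { p q zero → p ; p q (suc i) → q i })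
    (∈-allFin (v zero)) (colourings-complete r n (v ∘ suc))

  insert-cong : ∀ {n} j {π ρ : Permutation′ n} → π Perm.≈ ρ →
    Perm.insert zero j π Perm.≈ Perm.insert zero j ρ
  insert-cong j π≈ρ zero    = refl
  insert-cong j π≈ρ (suc k) = cong (punchIn j) (π≈ρ k)

  perms-complete : ∀ n (π : Permutation′ n) → Any (π Perm.≈_) (allPerms n)
  perms-complete zero    π = here (λ ())
  perms-complete (suc n) π = Anyₚ.cartesianProductWith⁺ (Perm.insert zero)
    (λ { {x} {ρ} refl π≈ρ i → trans (sym (Perm.insert-remove zero π i))
                                    (insert-cong x {Perm.remove zero π} {ρ} π≈ρ i) })
    (∈-allFin (π ⟨$⟩ʳ zero)) (perms-complete n (Perm.remove zero π))

  colouredPerms-complete : ∀ r n (g : ColouredPerm r n) → Any (g ≋_) (allColouredPerms r n)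
  colouredPerms-complete r n g = Anyₚ.cartesianProductWith⁺ _⨾_ _,_
    (colourings-complete r n (colour g)) (perms-complete n (perm g))

colourSum : ∀ {r n} → ColouredPerm r n → ℕ
colourSum g = Vector.foldr ℕ._+_ 0 (toℕ ∘ colour g)

-- G(r,p,n); equality of its elements is that of the first components.
SubG : (r p n : ℕ) → Set
SubG r p n = Σ[ g ∈ ColouredPerm r n ] p ∣ colourSum g

r/s-nonZero : ∀ {r s} .{{_ : NonZero r}} .{{_ : NonZero s}} → s ∣ r → NonZero (r / s)
r/s-nonZero s∣r = ℕ.>-nonZero (m≥n⇒m/n>0 (∣⇒≤ s∣r))

-- The quotient is a setoid on G(r,p,n) whose equality is membership in the
-- same coset of C_s (left and right cosets agree, C_s being central).
module Quotient (r p s n : ℕ) .{{_ : NonZero r}} .{{_ : NonZero s}} (s∣r : s ∣ r) where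
  private
    module 𝔾 = Group (G[_,_] {r} {n})
    open Mult 𝔾.monoid using (×-homo-+) renaming (_×_ to _×ᴳ_)

  -- C_s consists of the powers of the generator; it has finite order, so
  -- natural exponents suffice.
  generator : ColouredPerm r n
  generator = (λ _ → (r / s) mod r) ⨾ Perm.id

  infixr 8 _⊛_

  -- k ⊛ z is the k-th power of z.
  _⊛_ : ℕ → ColouredPerm r n → ColouredPerm r n
  k ⊛ z = k ×ᴳ z

  infix 4 _∼_
  _∼_ : Rel (SubG r p n) 0ℓ
  (g , _) ∼ (h , _) = ∃ λ k → h ≋ (k ⊛ generator) ∙ g

  power-colour : ∀ k i → colour (k ⊛ generator) i ≡ (k ℕ.* (r / s)) mod r
  power-perm   : ∀ k i → perm (k ⊛ generator) ⟨$⟩ʳ i ≡ i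
  power-perm zero    i = refl
  power-perm (suc k) i = power-perm k i
  power-colour zero    i = refl
  power-colour (suc k) i = begin
    colour (k ⊛ generator) i ⊕ (r / s) mod r   ≡⟨ cong (_⊕ (r / s) mod r) (power-colour k i) ⟩
    (k ℕ.* (r / s)) mod r ⊕ (r / s) mod r      ≡⟨ ⊕-mod (k ℕ.* (r / s)) (r / s) ⟩
    (k ℕ.* (r / s) ℕ.+ r / s) mod r            ≡⟨ cong (_mod r) (ℕₚ.+-comm _ (r / s)) ⟩
    (suc k ℕ.* (r / s)) mod r                  ∎
    where open ≡-Reasoning

  power-% : ∀ k → k ⊛ generator ≋ (k % s) ⊛ generator
  power-% k = (λ i → trans (power-colour k i) (trans (mod-cong _ _ eq) (sym (power-colour (k % s) i))))
            , (λ i → trans (power-perm k i) (sym (power-perm (k % s) i)))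
    where
    open ≡-Reasoning
    m = r / s
    eq : (k ℕ.* m) % r ≡ (k % s ℕ.* m) % r
    eq = begin
      (k ℕ.* m) % r                              ≡⟨ cong (λ z → (z ℕ.* m) % r) (m≡m%n+[m/n]*n k s) ⟩
      ((k % s ℕ.+ k / s ℕ.* s) ℕ.* m) % r        ≡⟨ cong (_% r) (ℕₚ.*-distribʳ-+ m (k % s) _) ⟩
      (k % s ℕ.* m ℕ.+ k / s ℕ.* s ℕ.* m) % r    ≡⟨ cong (λ z → (k % s ℕ.* m ℕ.+ z) % r) (ℕₚ.*-assoc (k / s) s m) ⟩
      (k % s ℕ.* m ℕ.+ k / s ℕ.* (s ℕ.* m)) % r  ≡⟨ cong (λ z → (k % s ℕ.* m ℕ.+ k / s ℕ.* z) % r) (m*[n/m]≡n s∣r) ⟩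
      (k % s ℕ.* m ℕ.+ k / s ℕ.* r) % r          ≡⟨ [m+kn]%n≡m%n (k % s ℕ.* m) (k / s) r ⟩
      (k % s ℕ.* m) % r                          ∎

  power-*s : ∀ k → (k ℕ.* s) ⊛ generator ≋ ε
  power-*s k = 𝔾.trans (power-% (k ℕ.* s)) (𝔾.reflexive (cong (_⊛ generator) (m*n%n≡0 k s)))

  power-cong : {z z′ : ColouredPerm r n} → z ≋ z′ → (g : ColouredPerm r n) → z ∙ g ≋ z′ ∙ g
  power-cong {z} {z′} eq g = 𝔾.∙-congʳ {g} {z} {z′} eq

  power-+ : ∀ j k (g : ColouredPerm r n) → (j ⊛ generator) ∙ ((k ⊛ generator) ∙ g) ≋ ((j ℕ.+ k) ⊛ generator) ∙ g
  power-+ j k g = 𝔾.trans (𝔾.sym (𝔾.assoc (j ⊛ generator) (k ⊛ generator) g))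
    (𝔾.sym (power-cong (×-homo-+ generator j k) g))

  ∼-refl : ∀ {x} → x ∼ x
  ∼-refl {g , _} = 0 , 𝔾.sym (𝔾.identityˡ g)

  ∼-sym : ∀ {x y} → x ∼ y → y ∼ x
  ∼-sym {g , _} {h , _} (k , h≋) = j , 𝔾.sym (begin
    (j ⊛ generator) ∙ h                      ≈⟨ 𝔾.∙-congˡ {j ⊛ generator} {h} {(k ⊛ generator) ∙ g} h≋ ⟩
    (j ⊛ generator) ∙ ((k ⊛ generator) ∙ g)  ≈⟨ power-+ j k g ⟩
    ((j ℕ.+ k) ⊛ generator) ∙ g              ≡⟨ cong (λ m → (m ⊛ generator) ∙ g) j+k≡ ⟩
    ((k ℕ.* s) ⊛ generator) ∙ g              ≈⟨ power-cong (power-*s k) g ⟩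
    ε ∙ g                                    ≈⟨ 𝔾.identityˡ g ⟩
    g                                        ∎)
    where
    open import Relation.Binary.Reasoning.Setoid 𝔾.setoid
    j = k ℕ.* s ∸ k
    j+k≡ : j ℕ.+ k ≡ k ℕ.* s
    j+k≡ = ℕₚ.m∸n+n≡m (ℕₚ.m≤m*n k s)

  ∼-trans : ∀ {x y z} → x ∼ y → y ∼ z → x ∼ z
  ∼-trans {x , _} {y , _} {z , _} (k , y≋) (j , z≋) = j ℕ.+ k ,
    𝔾.trans z≋ (𝔾.trans (𝔾.∙-congˡ {j ⊛ generator} {y} {(k ⊛ generator) ∙ x} y≋) (power-+ j k x))

  infix 4 _∼?_
  _∼?_ : Decidable _∼_
  (g , _) ∼? (h , _) = map′
    (λ (k , h≋) → toℕ k , h≋)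
    (λ (k , h≋) → k mod s , 𝔾.trans h≋ (power-cong (𝔾.trans (power-% k)
        (𝔾.reflexive (cong (_⊛ generator) (sym (toℕ-mod k))))) g))
    (Finₚ.any? (λ k → h ≋? (toℕ k ⊛ generator) ∙ g))

  G[r,p,s,n] : DecSetoid 0ℓ 0ℓ
  G[r,p,s,n] = record
    { Carrier = SubG r p n
    ; _≈_     = _∼_
    ; isDecEquivalence = record
      { isEquivalence = record
        { refl  = λ {x} → ∼-refl {x}
        ; sym   = λ {x} {y} → ∼-sym {x} {y}
        ; trans = λ {x} {y} {z} → ∼-trans {x} {y} {z}
        }
      ; _≟_           = _∼?_
      }
    }

  private
    inSubG? : ColouredPerm r n → Maybe (SubG r p n)
    inSubG? g with p ∣? colourSum g
    ... | yes p∣ = just (g , p∣)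
    ... | no  _  = nothing

  allSubG : List (SubG r p n)
  allSubG = mapMaybe inSubG? (allColouredPerms r n)

  -- One representative of each coset.
  elements : List (SubG r p n)
  elements = deduplicate _∼?_ allSubG

  private
    colourSum-cong : ∀ {g h : ColouredPerm r n} → g ≋ h → colourSum g ≡ colourSum h
    colourSum-cong (c≡ , _) = go c≡
      where
      go : ∀ {m} {u v : Vector (Fin r) m} → (∀ i → u i ≡ v i) →
           Vector.foldr ℕ._+_ 0 (toℕ ∘ u) ≡ Vector.foldr ℕ._+_ 0 (toℕ ∘ v)
      go {zero}  _  = refl
      go {suc m} eq = cong₂ ℕ._+_ (cong toℕ (eq zero)) (go (eq ∘ suc))

    inSubG-complete : ∀ (x : SubG r p n) {gs} → Any (proj₁ x ≋_) gs → Any (x ∼_) (mapMaybe inSubG? gs)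
    inSubG-complete x@(g , p∣) {h ∷ _} (here g≋h) with p ∣? colourSum h
    ... | yes _ = here (0 , 𝔾.trans (𝔾.sym g≋h) (𝔾.sym (𝔾.identityˡ g)))
    ... | no p∤ = contradiction (subst (p ∣_) (colourSum-cong {g} {h} g≋h) p∣) p∤
    inSubG-complete x {h ∷ _} (there any) with p ∣? colourSum h
    ... | yes _ = there (inSubG-complete x any)
    ... | no  _ = inSubG-complete x any

  elements-complete : IsEnumeration (DecSetoid.setoid G[r,p,s,n]) elements
  elements-complete = Enumerates.deduplicate⁺ G[r,p,s,n] {allSubG}
    (λ x → inSubG-complete x (colouredPerms-complete r n (proj₁ x)))

  elements-unique : Unique (DecSetoid.setoid G[r,p,s,n]) elements
  elements-unique = UniqueDec.deduplicate-! G[r,p,s,n] allSubG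

-- Statistics of a representative.  Positions and values 1,…,n are represented
-- by Fin n, so λ₁ is λᵢ at zero.

module Statistics (r s : ℕ) .{{_ : NonZero r}} .{{_ : NonZero s}} (s∣r : s ∣ r) where
  private
    instance
      r/s≢0 : NonZero (r / s)
      r/s≢0 = r/s-nonZero s∣r

  ℤcolour : ∀ {n} → Vector (Fin r) n → Fin n → ℤ
  ℤcolour c i = ℤ.+ toℕ (c i)

  IsHDes : ∀ {n} → ColouredPerm r n → Fin n → Set
  IsHDes g i = ∃ λ i+1 → toℕ i+1 ≡ suc (toℕ i)
    × colour g i ≡ colour g i+1 × (perm g ⟨$⟩ʳ i) Fin.> (perm g ⟨$⟩ʳ i+1)

  isHDes? : ∀ {n} (g : ColouredPerm r n) (i : Fin n) → Dec (IsHDes g i)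
  isHDes? g i = Finₚ.any? λ i+1 → (toℕ i+1 ℕₚ.≟ suc (toℕ i))
    ×-dec (colour g i Finₚ.≟ colour g i+1) ×-dec ((perm g ⟨$⟩ʳ i+1) Finₚ.<? (perm g ⟨$⟩ʳ i))

  HDes : ∀ {n} → ColouredPerm r n → List (Fin n)
  HDes {n} g = filter (isHDes? g) (allFin n)

  h : ∀ {n} → ColouredPerm r n → Fin n → ℕ
  h g i = length (filter (i Finₚ.≤?_) (HDes g))

  -- Recursion from the last position: kOf (c₁ , … , cₙ) i = kᵢ.
  kOf : ∀ {n} → Vector (Fin r) n → Fin n → ℕ
  kOf {suc zero}    c zero    = Residue (r / s) (ℤcolour c zero)
  kOf {suc (suc n)} c zero    =
    kOf (Vector.tail c) zero ℕ.+ Residue r (ℤcolour c zero ℤ.- ℤcolour c (suc zero))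
  kOf {suc (suc n)} c (suc i) = kOf (Vector.tail c) i

  λᵢ : ∀ {n} → ColouredPerm r n → Fin n → ℕ
  λᵢ g i = r ℕ.* h g i ℕ.+ kOf (colour g) i

  first : ∀ {n} .{{_ : NonZero n}} → Fin n
  first {suc n} = zero

  fmaj : ∀ {n} → ColouredPerm r n → ℕ
  fmaj g = Vector.foldr ℕ._+_ 0 (λᵢ g)

  -- s ≤ r, so the truncated subtraction is exact.
  des : ∀ {n} .{{_ : NonZero n}} → ColouredPerm r n → ℕ
  des g = (s ℕ.* λᵢ g first ℕ.+ r ∸ s) / r

  col : ∀ {n} → ColouredPerm r n → ℕ
  col g = Vector.foldr ℕ._+_ 0 (λ i → Residue (r / s) (ℤcolour (colour g) i))

module LeftSide where
  open RingOps ℤ⟦q,a⟧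

  q a : Carrier
  q = PowerSeries.var ℤ⟦a⟧
  a = PowerSeries.const ℤ⟦a⟧ (PowerSeries.var ℤ.+-*-rawRing)

  base : (r s : ℕ) .{{_ : NonZero s}} → ℕ → Carrier
  base r s k = [ suc k ] (q ^ (r / s)) + a * q * [ k ] (q ^ (r / s)) * [ r / s ∸ 1 ] (a * q)

open LeftSide public using (base)
open RingOps ℤ⟦q,a⟧ public using () renaming (_^_ to _^qa_)
open RawRing ℤ⟦t,q,a⟧ public using () renaming (_≈_ to _≈tqa_)
open PowerSeries ℤ⟦q,a⟧ public using (_÷_)

module RightSide where
  open RingOps ℤ⟦t,q,a⟧

  t q a : Carrier
  t = PowerSeries.var ℤ⟦q,a⟧
  q = PowerSeries.const ℤ⟦q,a⟧ LeftSide.q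
  a = PowerSeries.const ℤ⟦q,a⟧ LeftSide.a

  numerator : (r p s n : ℕ) .{{_ : NonZero r}} .{{_ : NonZero s}} .{{_ : NonZero n}} →
    s ∣ r → Carrier
  numerator r p s n s∣r = List.foldr _+_ 0# (List.map (weight ∘ proj₁) elements)
    where
    open Quotient r p s n s∣r using (elements)
    open Statistics r s s∣r using (des; fmaj; col)
    weight : ColouredPerm r n → Carrier
    weight g = t ^ des g * q ^ fmaj g * a ^ col g

  -- The factors of the product are 1 - tˢ q^(ir) for i = 1,…,n-1.
  denominator : (r s n : ℕ) .{{_ : NonZero s}} → Carrier
  denominator r s n =
    (1# - t)
    * product {n ∸ 1} (λ i → 1# - t ^ s * q ^ (suc (toℕ i) ℕ.* r))
    * (1# - t * q ^ (n ℕ.* r / s))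

open RightSide public using (numerator; denominator)

{-# OPTIONS --safe #-}

-- With m = r/s, the base on the left is ∑ q^x a^(x mod m) over 0 ≤ x ≤ k m, so
-- the coefficient of t^k on the left enumerates the words f₁ … fₙ with letters
-- at most k m and p ∣ ∑ fᵢ, with weight q^(∑ fᵢ) a^(∑ fᵢ mod m).  List the
-- positions of such a word by decreasing letter, equal letters from left to
-- right: this is a permutation σ, and together with the colours
-- cᵢ = f_{σ(i)} mod r it gives an element g of G(r,p,s,n).  The differences of
-- consecutive letters f_{σ(i)} are
--   kᵢ - kᵢ₊₁ + r ([i ∈ HDes] + bᵢ)  for i < n,  and  kₙ + m bₙ  for i = n,
-- with arbitrary natural numbers bᵢ, and the word is determined by the coset g
-- and b.  Its letters sum to fmaj g + ∑ i r bᵢ + n m bₙ, and the largest one is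
-- at most k m if and only if des g + s (b₁ + ⋯ + bₙ₋₁) + bₙ ≤ k.  Hence the
-- pairs (g , b), with a slack variable b₀ for the factor 1 - t, are enumerated
-- by the right side.

module Submission where

open import Defs
open import Algebra.Bundles using (RawRing; CommutativeRing)
open import Data.Bool.Base using (Bool; true; false; if_then_else_)
open import Data.Empty using (⊥)
open import Data.Fin.Base as Fin using (Fin; zero; suc; toℕ; punchIn; fromℕ<)
import Data.Fin.Properties as Finₚ
open import Data.Fin.Permutation as Perm using (Permutation′; _⟨$⟩ʳ_; _⟨$⟩ˡ_)
open import Data.Integer.Base as ℤ using (ℤ)
import Data.Integer.DivMod as ℤᵈ
import Data.Integer.Properties as ℤₚ
open import Data.List.Base as List
  using (List; []; _∷_; _++_; map; concatMap; filter; length; tabulate; downFrom; cartesianProductWith)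
open import Data.List.Membership.Propositional using (_∈_; find)
open import Data.List.Membership.Propositional.Properties
open import Data.List.Membership.Propositional.Properties.WithK using (unique∧set⇒bag)
open import Data.List.Relation.Binary.BagAndSetEquality using (∼bag⇒↭)
open import Data.List.Relation.Binary.Disjoint.Propositional using (Disjoint)
import Data.List.Relation.Binary.Permutation.Propositional as ↭
open import Data.List.Relation.Binary.Permutation.Propositional using (_↭_)
open import Data.List.Relation.Unary.All as All using (All; []; _∷_)
import Data.List.Relation.Unary.All.Properties as Allₚ
open import Data.List.Relation.Unary.AllPairs as AllPairs using (AllPairs; []; _∷_)
import Data.List.Relation.Unary.AllPairs.Properties as AllPairsₚ
open import Data.List.Relation.Unary.Any as Any using (Any; here; there)
open import Data.List.Relation.Unary.Unique.Propositional using (Unique)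
import Data.List.Relation.Unary.Unique.Propositional.Properties as Uniqueₚ
open import Data.Nat.Base as ℕ using (ℕ; zero; suc; _≤_; _<_; z≤n; s≤s; NonZero; _∸_; _/_; _%_)
open import Data.Nat.DivMod
import Data.Nat.Properties as ℕₚ
open import Data.Nat.Divisibility
open import Data.Nat.Solver using (module +-*-Solver)
open import Data.Product.Base using (∃; Σ-syntax; _×_; _,_; proj₁; proj₂)
open import Data.Sum.Base using (_⊎_; inj₁; inj₂)
open import Data.Vec.Base as Vec using (Vec; []; _∷_)
import Data.Vec.Properties as Vecₚ
open import Data.Vec.Functional as Vector using (Vector)
open import Function.Base using (_∘_; id)
open import Function.Bundles using (mk⇔)
open import Relation.Binary.Definitions using (tri<; tri≈; tri>)
open import Relation.Binary.PropositionalEquality as ≡ using (_≡_; _≢_)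
import Relation.Binary.Reasoning.Setoid as SetoidReasoning
open import Relation.Nullary using (Dec; does; yes; no; ¬_; contradiction)
open import Relation.Unary using (Pred; Decidable)

-- Formal power series

-- The delicate point is the quotient by C_s. Since kₙ retains cₙ only modulo m, the letters built
-- from g and b agree modulo r with the colours of g only up to a common shift m z, and such a shift
-- of all colours is precisely the action of a power of the generator. `Compatible` records this
-- shift, and statements about cosets become computations with z; as m s = r, subtracting m z is
-- written as adding m (s - 1) z, which stays in ℕ. The hypothesis ps ∣ rn enters here: the shift
-- changes the colour sum by n m z, and p divides n m. The summand r [i ∈ HDes] is forced by the
-- rule for ties. Where neighbouring colours agree, the difference of the letters is a multiple of
-- r, and it may vanish only if the two positions in the word increase. The series quotient is
-- defined by a recursively computed inverse, which is never expanded. The enumeration of the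
-- exponents b satisfies the equation of a reciprocal of the denominator, and reciprocals are
-- unique.

module SeriesRing {c ℓ} (R : CommutativeRing c ℓ) where
  open CommutativeRing R
  open PowerSeries rawRing using (Series; const; var; _⊗_)
  open import Algebra.Properties.CommutativeSemigroup +-commutativeSemigroup using (interchange; x∙yz≈y∙xz)
  open SetoidReasoning setoid

  infix 4 _≐_
  _≐_ : Series → Series → Set ℓ
  f ≐ g = ∀ n → f n ≈ g n

  -- By computation `(f ⊗ g) (suc n)` is `f 0 * g (suc n) + ((f ∘ suc) ⊗ g) n`. This and the laws
  -- below are therefore inductions on the index in which the first factor loses its head.
  ⊗-cong : ∀ {f f′ g g′} → f ≐ f′ → g ≐ g′ → f ⊗ g ≐ f′ ⊗ g′
  ⊗-cong p q zero    = +-congʳ (*-cong (p 0) (q 0))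
  ⊗-cong p q (suc n) = +-cong (*-cong (p 0) (q (suc n))) (⊗-cong (p ∘ suc) q n)

  ⊗-zeroˡ : ∀ g → (λ _ → 0#) ⊗ g ≐ λ _ → 0#
  ⊗-zeroˡ g zero    = trans (+-identityʳ _) (zeroˡ _)
  ⊗-zeroˡ g (suc n) = trans (+-cong (zeroˡ _) (⊗-zeroˡ g n)) (+-identityʳ _)

  const-⊗ : ∀ x g → const x ⊗ g ≐ λ n → x * g n
  const-⊗ x g zero    = +-identityʳ _
  const-⊗ x g (suc n) = trans (+-congˡ (⊗-zeroˡ g n)) (+-identityʳ _)

  ⊗-scaleˡ : ∀ x f g → (λ n → x * f n) ⊗ g ≐ λ n → x * (f ⊗ g) n
  ⊗-scaleˡ x f g zero = begin
    x * f 0 * g 0 + 0#    ≈⟨ +-identityʳ _ ⟩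
    x * f 0 * g 0         ≈⟨ *-assoc x _ _ ⟩
    x * (f 0 * g 0)       ≈⟨ *-congˡ (+-identityʳ _) ⟨
    x * (f 0 * g 0 + 0#)  ∎
  ⊗-scaleˡ x f g (suc n) = trans (+-cong (*-assoc x _ _) (⊗-scaleˡ x (f ∘ suc) g n))
    (sym (distribˡ x _ _))

  ⊗-distribʳ : ∀ f g h → (λ n → f n + g n) ⊗ h ≐ λ n → (f ⊗ h) n + (g ⊗ h) n
  ⊗-distribʳ f g h zero = begin
    (f 0 + g 0) * h 0 + 0#               ≈⟨ +-identityʳ _ ⟩
    (f 0 + g 0) * h 0                    ≈⟨ distribʳ _ _ _ ⟩
    f 0 * h 0 + g 0 * h 0                ≈⟨ +-cong (+-identityʳ _) (+-identityʳ _) ⟨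
    f 0 * h 0 + 0# + (g 0 * h 0 + 0#)    ∎
  ⊗-distribʳ f g h (suc n) =
    trans (+-cong (distribʳ _ _ _) (⊗-distribʳ (f ∘ suc) (g ∘ suc) h n)) (interchange _ _ _ _)

  ⊗-assoc : ∀ f g h → (f ⊗ g) ⊗ h ≐ f ⊗ (g ⊗ h)
  ⊗-assoc f g h zero = +-congʳ (begin
    (f 0 * g 0 + 0#) * h 0   ≈⟨ *-congʳ (+-identityʳ _) ⟩
    f 0 * g 0 * h 0          ≈⟨ *-assoc _ _ _ ⟩
    f 0 * (g 0 * h 0)        ≈⟨ *-congˡ (+-identityʳ _) ⟨
    f 0 * (g 0 * h 0 + 0#)   ∎)
  ⊗-assoc f g h (suc n) = begin
    (f 0 * g 0 + 0#) * h (suc n) + (((f ⊗ g) ∘ suc) ⊗ h) n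
      ≈⟨ +-cong (*-congʳ (+-identityʳ _)) (⊗-distribʳ (λ k → f 0 * g (suc k)) ((f ∘ suc) ⊗ g) h n) ⟩
    f 0 * g 0 * h (suc n) + (((λ k → f 0 * g (suc k)) ⊗ h) n + (((f ∘ suc) ⊗ g) ⊗ h) n)
      ≈⟨ +-cong (*-assoc _ _ _) (+-cong (⊗-scaleˡ (f 0) (g ∘ suc) h n) (⊗-assoc (f ∘ suc) g h n)) ⟩
    f 0 * (g 0 * h (suc n)) + (f 0 * ((g ∘ suc) ⊗ h) n + ((f ∘ suc) ⊗ (g ⊗ h)) n)
      ≈⟨ +-assoc _ _ _ ⟨
    f 0 * (g 0 * h (suc n)) + f 0 * ((g ∘ suc) ⊗ h) n + ((f ∘ suc) ⊗ (g ⊗ h)) n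
      ≈⟨ +-congʳ (distribˡ _ _ _) ⟨
    f 0 * (g ⊗ h) (suc n) + ((f ∘ suc) ⊗ (g ⊗ h)) n ∎

  -- The mirror image of the defining recursion, with the second factor losing its head;
  -- commutativity follows by playing the two against each other.
  ⊗-last : ∀ f g n → (f ⊗ g) (suc n) ≈ f (suc n) * g 0 + (f ⊗ (g ∘ suc)) n
  ⊗-last f g zero    = x∙yz≈y∙xz _ _ _
  ⊗-last f g (suc n) = trans (+-congˡ (⊗-last (f ∘ suc) g n)) (x∙yz≈y∙xz _ _ _)

  ⊗-comm : ∀ f g → f ⊗ g ≐ g ⊗ f
  ⊗-comm f g zero    = +-congʳ (*-comm _ _)
  ⊗-comm f g (suc n) = trans (+-cong (*-comm _ _) (⊗-comm (f ∘ suc) g n)) (sym (⊗-last g f n))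

  ⊗-identityˡ : ∀ f → const 1# ⊗ f ≐ f
  ⊗-identityˡ f n = trans (const-⊗ 1# f n) (*-identityˡ _)

  seriesRing : CommutativeRing c ℓ
  seriesRing = record
    { RawRing (PowerSeries.rawRing rawRing)
    ; isCommutativeRing = record
      { isRing = record
        { +-isAbelianGroup = record
          { isGroup = record
            { isMonoid = record
              { isSemigroup = record
                { isMagma = record
                  { isEquivalence = record
                    { refl  = λ n → refl
                    ; sym   = λ p n → sym (p n)
                    ; trans = λ p q n → trans (p n) (q n)
                    }
                  ; ∙-cong = λ p q n → +-cong (p n) (q n)
                  }
                ; assoc = λ f g h n → +-assoc _ _ _
                }
              ; identity = (λ f n → +-identityˡ _) , (λ f n → +-identityʳ _)
              }
            ; inverse = (λ f n → -‿inverseˡ _) , (λ f n → -‿inverseʳ _)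
            ; ⁻¹-cong = λ p n → -‿cong (p n)
            }
          ; comm = λ f g n → +-comm _ _
          }
        ; *-cong = ⊗-cong
        ; *-assoc = ⊗-assoc
        ; *-identity = ⊗-identityˡ , (λ f n → trans (⊗-comm f (const 1#) n) (⊗-identityˡ f n))
        ; distrib = (λ f g h n → trans (⊗-comm f (λ k → g k + h k) n)
                      (trans (⊗-distribʳ g h f n) (+-cong (⊗-comm g f n) (⊗-comm h f n))))
                  , (λ h f g → ⊗-distribʳ f g h)
        }
      ; *-comm = ⊗-comm
      }
    }

-- The default `d` is a parameter because the same shift serves for coefficients, with `0#`, and for
-- the lists that enumerate them, with `[]`.
shift : ∀ {c} {X : Set c} → X → ℕ → (ℕ → X) → ℕ → X
shift d zero    f n       = f n
shift d (suc A) f zero    = d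
shift d (suc A) f (suc n) = shift d A f n

module Monomials {c ℓ} (R : CommutativeRing c ℓ) where
  open CommutativeRing R
  open PowerSeries rawRing using (Series; const; var; _⊗_)
  open SeriesRing R
  open RingOps rawRing using (_^_)
  open RingOps (PowerSeries.rawRing rawRing) using () renaming (_^_ to _^ₛ_)

  const-^ : ∀ x k → const x ^ₛ k ≐ const (x ^ k)
  const-^ x zero    n       = refl
  const-^ x (suc k) zero    = trans (const-⊗ x (const x ^ₛ k) 0) (*-congˡ (const-^ x k 0))
  const-^ x (suc k) (suc n) = trans (const-⊗ x (const x ^ₛ k) (suc n)) (trans (*-congˡ (const-^ x k (suc n))) (zeroʳ _))

  var-⊗ : ∀ f → var ⊗ f ≐ shift 0# 1 f
  var-⊗ f zero = trans (+-identityʳ _) (zeroˡ _)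
  var-⊗ f (suc n) = trans (+-cong (zeroˡ _)
    (⊗-cong {var ∘ suc} {const 1#} {f} {f} (λ { zero → refl ; (suc _) → refl }) (λ _ → refl) n))
    (trans (+-identityˡ _) (⊗-identityˡ f n))

  shift-cong : ∀ A {f g} → f ≐ g → shift 0# A f ≐ shift 0# A g
  shift-cong zero    p n       = p n
  shift-cong (suc A) p zero    = refl
  shift-cong (suc A) p (suc n) = shift-cong A p n

  shift-shift : ∀ A f n → shift 0# 1 (shift 0# A f) n ≈ shift 0# (suc A) f n
  shift-shift A f zero    = refl
  shift-shift A f (suc n) = refl

  var^-⊗ : ∀ A f → (var ^ₛ A) ⊗ f ≐ shift 0# A f
  var^-⊗ zero    f n = ⊗-identityˡ f n
  var^-⊗ (suc A) f n = trans (⊗-assoc var (var ^ₛ A) f n) (trans (var-⊗ ((var ^ₛ A) ⊗ f) n)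
    (trans (shift-cong 1 (var^-⊗ A f) n) (shift-shift A f n)))

-- Sums over lists

module ListSums {c ℓ} (R : CommutativeRing c ℓ) where
  open CommutativeRing R
  open import Algebra.Properties.CommutativeSemigroup +-commutativeSemigroup using (x∙yz≈y∙xz)

  ∑ : ∀ {x} {X : Set x} → (X → Carrier) → List X → Carrier
  ∑ f xs = List.foldr _+_ 0# (map f xs)

  module _ {x} {X : Set x} where

    ∑-cong : ∀ {f g : X → Carrier} → (∀ x → f x ≈ g x) → ∀ xs → ∑ f xs ≈ ∑ g xs
    ∑-cong p []       = refl
    ∑-cong p (x ∷ xs) = +-cong (p x) (∑-cong p xs)

    ∑-++ : ∀ (f : X → Carrier) xs ys → ∑ f (xs ++ ys) ≈ ∑ f xs + ∑ f ys
    ∑-++ f []       ys = sym (+-identityˡ _)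
    ∑-++ f (x ∷ xs) ys = trans (+-congˡ (∑-++ f xs ys)) (sym (+-assoc _ _ _))

    ∑-*ˡ : ∀ y (f : X → Carrier) xs → y * ∑ f xs ≈ ∑ (λ x → y * f x) xs
    ∑-*ˡ y f []       = zeroʳ y
    ∑-*ˡ y f (x ∷ xs) = trans (distribˡ _ _ _) (+-congˡ (∑-*ˡ y f xs))

    ∑-↭ : ∀ (f : X → Carrier) {xs ys} → xs ↭ ys → ∑ f xs ≈ ∑ f ys
    ∑-↭ f ↭.refl         = refl
    ∑-↭ f (↭.prep x p)   = +-congˡ (∑-↭ f p)
    ∑-↭ f (↭.swap x y p) = trans (+-congˡ (+-congˡ (∑-↭ f p))) (x∙yz≈y∙xz _ _ _)
    ∑-↭ f (↭.trans p q)  = trans (∑-↭ f p) (∑-↭ f q)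

    ∑-shift : ∀ (f : X → Carrier) A L k →
      shift 0# A (λ k → ∑ f (L k)) k ≈ ∑ f (shift [] A L k)
    ∑-shift f zero    L k       = refl
    ∑-shift f (suc A) L zero    = refl
    ∑-shift f (suc A) L (suc k) = ∑-shift f A L k

  module _ {x} {X : Set x} where

    ∑-map : ∀ {y} {Y : Set y} (f : Y → Carrier) (h : X → Y) xs →
      ∑ f (map h xs) ≈ ∑ (f ∘ h) xs
    ∑-map f h []       = refl
    ∑-map f h (x ∷ xs) = +-congˡ (∑-map f h xs)

  module _ {x} {X : Set x} where

    ∑-concatMap : ∀ {y} {Y : Set y} (f : Y → Carrier) (h : X → List Y) xs →
      ∑ f (concatMap h xs) ≈ ∑ (λ x → ∑ f (h x)) xs
    ∑-concatMap f h []       = refl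
    ∑-concatMap f h (x ∷ xs) = trans (∑-++ f (h x) _) (+-congˡ (∑-concatMap f h xs))

    ∑-cartesianProductWith : ∀ {y z} {Y : Set y} {Z : Set z} (h : X → Y → Z)
      (f : Z → Carrier) (u : X → Carrier) (v : Y → Carrier) →
      (∀ x y → f (h x y) ≈ u x * v y) → ∀ xs ys →
      ∑ f (cartesianProductWith h xs ys) ≈ ∑ u xs * ∑ v ys
    ∑-cartesianProductWith h f u v p []       ys = sym (zeroˡ _)
    ∑-cartesianProductWith h f u v p (x ∷ xs) ys = trans (∑-++ f (map (h x) ys) _)
      (trans (+-cong (trans (∑-map f (h x) ys) (trans (∑-cong (p x) ys) (sym (∑-*ˡ (u x) v ys))))
                     (∑-cartesianProductWith h f u v p xs ys))
             (sym (distribʳ _ _ _)))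

tuples : ∀ {x} {X : Set x} → List X → ∀ n → List (Vec X n)
tuples xs zero    = [] ∷ []
tuples xs (suc n) = cartesianProductWith _∷_ xs (tuples xs n)

tuples-unique : ∀ {x} {X : Set x} {xs : List X} → Unique xs → ∀ n → Unique (tuples xs n)
tuples-unique u zero    = [] ∷ []
tuples-unique u (suc n) = Uniqueₚ.cartesianProductWith⁺ _∷_
  (λ { ≡.refl → ≡.refl , ≡.refl }) u (tuples-unique u n)

-- The left side as a sum over words

module BaseExpansion {c ℓ} (R : CommutativeRing c ℓ) (q a : CommutativeRing.Carrier R) where
  open CommutativeRing R
  open RingOps rawRing using (_^_; [_]_)
  open import Algebra.Properties.Semiring.Exp semiring using (^-homo-*; ^-assocʳ; ^-congʳ; ^-congˡ)
  open import Algebra.Properties.CommutativeSemiring.Exp commutativeSemiring using (^-distrib-*)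
  open import Algebra.Properties.Monoid.Sum +-monoid using (sum-init-last; sum-cong-≗)
  open import Algebra.Solver.Ring.NaturalCoefficients.Default commutativeSemiring
  open ListSums R
  open SetoidReasoning setoid

  bracket-suc : ∀ n x → [ suc n ] x ≈ [ n ] x + x ^ n
  bracket-suc n x = trans (sum-init-last {n} (λ i → x ^ toℕ i))
    (+-cong (reflexive (sum-cong-≗ {n} (λ i → ≡.cong (x ^_) (Finₚ.toℕ-inject₁ i))))
            (^-congʳ x (Finₚ.toℕ-fromℕ n)))

  module _ (m : ℕ) .{{_ : NonZero m}} where

    mono : ℕ → Carrier
    mono x = q ^ x * a ^ (x % m)

    -- The new letters are k m + j with 1 ≤ j ≤ L. As j < m, their residue modulo m is j itself, so
    -- each contributes q^(k m) (a q)^j.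
    partial-base : ∀ k L → L < m →
      ∑ mono (downFrom (L ℕ.+ suc (k ℕ.* m))) ≈
      ∑ mono (downFrom (suc (k ℕ.* m))) + a * q * (q ^ m) ^ k * [ L ] (a * q)
    partial-base k zero    _   = sym (trans (+-congˡ (zeroʳ _)) (+-identityʳ _))
    partial-base k (suc L) L<m = begin
      mono (L ℕ.+ suc (k ℕ.* m)) + ∑ mono (downFrom (L ℕ.+ suc (k ℕ.* m)))
        ≈⟨ +-cong mono≈ (partial-base k L (ℕₚ.<⇒≤ L<m)) ⟩
      q * q ^ L * (q ^ m) ^ k * (a * a ^ L) + (S + a * q * (q ^ m) ^ k * [ L ] (a * q))
        ≈⟨ solve 7 (λ a q x y z s b →
             q :* x :* z :* (a :* y) :+ (s :+ a :* q :* z :* b) :=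
             s :+ a :* q :* z :* (b :+ y :* x)) refl
             a q (q ^ L) (a ^ L) ((q ^ m) ^ k) S ([ L ] (a * q)) ⟩
      S + a * q * (q ^ m) ^ k * ([ L ] (a * q) + a ^ L * q ^ L)
        ≈⟨ +-congˡ (*-congˡ (+-congˡ (^-distrib-* a q L))) ⟨
      S + a * q * (q ^ m) ^ k * ([ L ] (a * q) + (a * q) ^ L)
        ≈⟨ +-congˡ (*-congˡ (bracket-suc L (a * q))) ⟨
      S + a * q * (q ^ m) ^ k * [ suc L ] (a * q) ∎
      where
      S = ∑ mono (downFrom (suc (k ℕ.* m)))
      mono≈ : mono (L ℕ.+ suc (k ℕ.* m)) ≈ q * q ^ L * (q ^ m) ^ k * (a * a ^ L)
      mono≈ = begin
        mono (L ℕ.+ suc (k ℕ.* m))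
          ≡⟨ ≡.cong mono (ℕₚ.+-suc L (k ℕ.* m)) ⟩
        q ^ (suc L ℕ.+ k ℕ.* m) * a ^ ((suc L ℕ.+ k ℕ.* m) % m)
          ≈⟨ *-cong (^-homo-* q (suc L) (k ℕ.* m))
               (^-congʳ a (≡.trans ([m+kn]%n≡m%n (suc L) k m) (m<n⇒m%n≡m L<m))) ⟩
        q ^ suc L * q ^ (k ℕ.* m) * a ^ suc L
          ≈⟨ *-congʳ (*-congˡ (trans (^-congʳ q (ℕₚ.*-comm k m)) (sym (^-assocʳ q m k)))) ⟩
        q * q ^ L * (q ^ m) ^ k * (a * a ^ L) ∎

    mono-* : ∀ k → mono (k ℕ.* m) ≈ (q ^ m) ^ k
    mono-* k = begin
      q ^ (k ℕ.* m) * a ^ ((k ℕ.* m) % m)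
        ≈⟨ *-cong (^-congʳ q (ℕₚ.*-comm k m)) (^-congʳ a (m*n%n≡0 k m)) ⟩
      q ^ (m ℕ.* k) * 1#   ≈⟨ *-identityʳ _ ⟩
      q ^ (m ℕ.* k)        ≈⟨ ^-assocʳ q m k ⟨
      (q ^ m) ^ k          ∎

    -- From k to k + 1, the last term of the second bracket accounts for the m - 1 letters strictly
    -- between k m and (k + 1) m, and the last term of the first bracket for the letter (k + 1) m.
    base-expansion : ∀ k →
      [ suc k ] (q ^ m) + a * q * [ k ] (q ^ m) * [ m ℕ.∸ 1 ] (a * q) ≈
      ∑ mono (downFrom (suc (k ℕ.* m)))
    base-expansion zero = trans
      (+-congˡ (trans (*-congʳ (zeroʳ _)) (zeroˡ _)))
      (trans (+-identityʳ _) (+-congʳ (sym (mono-* 0))))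
    base-expansion (suc k) = begin
      [ suc (suc k) ] x + a * q * [ suc k ] x * [ m ℕ.∸ 1 ] (a * q)
        ≈⟨ +-cong (bracket-suc (suc k) x) (*-congʳ (*-congˡ (bracket-suc k x))) ⟩
      [ suc k ] x + x ^ suc k + a * q * ([ k ] x + x ^ k) * M
        ≈⟨ solve 6 (λ w b y z v u →
             b :+ y :+ w :* (v :+ z) :* u := y :+ (b :+ w :* v :* u :+ w :* z :* u)) refl
             (a * q) ([ suc k ] x) (x ^ suc k) (x ^ k) ([ k ] x) M ⟩
      x ^ suc k + ([ suc k ] x + a * q * [ k ] x * M + a * q * x ^ k * M)
        ≈⟨ +-cong (sym (mono-* (suc k))) (+-congʳ (base-expansion k)) ⟩
      mono (suc k ℕ.* m) + (∑ mono (downFrom (suc (k ℕ.* m))) + a * q * x ^ k * M)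
        ≈⟨ +-congˡ (partial-base k (m ℕ.∸ 1) (ℕₚ.≤-reflexive (ℕₚ.suc-pred m))) ⟨
      mono (suc k ℕ.* m) + ∑ mono (downFrom (m ℕ.∸ 1 ℕ.+ suc (k ℕ.* m)))
        ≡⟨ ≡.cong (λ j → mono (suc k ℕ.* m) + ∑ mono (downFrom j)) (
             ≡.trans (ℕₚ.+-suc (m ℕ.∸ 1) _) (≡.cong (ℕ._+ k ℕ.* m) (ℕₚ.suc-pred m))) ⟩
      mono (suc k ℕ.* m) + ∑ mono (downFrom (suc k ℕ.* m)) ∎
      where
      x = q ^ m
      M = [ m ℕ.∸ 1 ] (a * q)

    monos : ∀ {n} → Vec ℕ n → Carrier
    monos v = q ^ Vec.sum v * a ^ Vec.sum (Vec.map (_% m) v)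

    power-expansion : ∀ xs n → ∑ mono xs ^ n ≈ ∑ monos (tuples xs n)
    power-expansion xs zero    = sym (trans (+-identityʳ _) (*-identityʳ _))
    power-expansion xs (suc n) = sym (trans
      (∑-cartesianProductWith _∷_ monos mono monos split xs (tuples xs n))
      (*-congˡ (sym (power-expansion xs n))))
      where
      split : ∀ x v → monos (x ∷ v) ≈ mono x * monos v
      split x v = trans (*-cong (^-homo-* q x _) (^-homo-* a (x % m) _))
        (solve 4 (λ x y z w → x :* y :* (z :* w) := x :* z :* (y :* w)) refl _ _ _ _)

    base^n-expansion : ∀ k n →
      ([ suc k ] (q ^ m) + a * q * [ k ] (q ^ m) * [ m ℕ.∸ 1 ] (a * q)) ^ n ≈
      ∑ monos (tuples (downFrom (suc (k ℕ.* m))) n)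
    base^n-expansion k n = trans (^-congˡ n (base-expansion k))
      (power-expansion (downFrom (suc (k ℕ.* m))) n)

-- The way from bijections to equal sums: for lists without repetition two inclusions suffice, and
-- sums are invariant under permutation.
unique∧set⇒↭ : ∀ {x} {X : Set x} {xs ys : List X} → Unique xs → Unique ys →
  (∀ {x} → x ∈ xs → x ∈ ys) → (∀ {x} → x ∈ ys → x ∈ xs) → xs ↭ ys
unique∧set⇒↭ u v f g = ∼bag⇒↭ (unique∧set⇒bag u v (mk⇔ f g))

∈-tuples⁺ : ∀ {x} {X : Set x} (xs : List X) {n} (v : Vec X n) →
  (∀ i → Vec.lookup v i ∈ xs) → v ∈ tuples xs n
∈-tuples⁺ xs []      p = here ≡.refl
∈-tuples⁺ xs (x ∷ v) p = ∈-cartesianProductWith⁺ _∷_ (p zero) (∈-tuples⁺ xs v (p ∘ suc))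

∈-tuples⁻ : ∀ {x} {X : Set x} (xs : List X) {n} (v : Vec X n) →
  v ∈ tuples xs n → ∀ i → Vec.lookup v i ∈ xs
∈-tuples⁻ xs (x ∷ v) p i with ∈-cartesianProductWith⁻ _∷_ xs (tuples xs _) p
∈-tuples⁻ xs (x ∷ v) p zero    | _ , _ , x∈ , v∈ , ≡.refl = x∈
∈-tuples⁻ xs (x ∷ v) p (suc i) | _ , _ , x∈ , v∈ , ≡.refl = ∈-tuples⁻ xs v v∈ i

module _ {x} {X : Set x} where

  ∈-shift⁺ : ∀ A (L : ℕ → List X) {y k} → y ∈ L k → y ∈ shift [] A L (A ℕ.+ k)
  ∈-shift⁺ zero    L p = p
  ∈-shift⁺ (suc A) L p = ∈-shift⁺ A L p

  ∈-shift⁻ : ∀ A (L : ℕ → List X) {y} k → y ∈ shift [] A L k → ∃ λ j → k ≡ A ℕ.+ j × y ∈ L j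
  ∈-shift⁻ zero    L k       p = k , ≡.refl , p
  ∈-shift⁻ (suc A) L (suc k) p with j , eq , y∈ ← ∈-shift⁻ A L k p = j , ≡.cong suc eq , y∈

  shift-unique : ∀ A (L : ℕ → List X) → (∀ k → Unique (L k)) → ∀ k → Unique (shift [] A L k)
  shift-unique zero    L u k       = u k
  shift-unique (suc A) L u zero    = []
  shift-unique (suc A) L u (suc k) = shift-unique A L u k

-- Exponent vectors and the reciprocal of the denominator

dot : ∀ {n} → Vector ℕ n → Vec ℕ n → ℕ
dot A []      = 0
dot A (x ∷ v) = A zero ℕ.* x ℕ.+ dot (A ∘ suc) v

lookup≤dot : ∀ {n} {A : Vector ℕ n} → (∀ i → 0 < A i) → ∀ v i → Vec.lookup v i ≤ dot A v
lookup≤dot {A = A} p (x ∷ v) zero =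
  ℕₚ.≤-trans (ℕₚ.m≤n*m x (A zero) {{ℕ.>-nonZero (p zero)}}) (ℕₚ.m≤m+n _ _)
lookup≤dot p (x ∷ v) (suc i) = ℕₚ.≤-trans (lookup≤dot (p ∘ suc) v i) (ℕₚ.m≤n+m _ _)

-- No solution is lost by bounding the entries by k if the weights A are positive.
solutions : ∀ {n} → Vector ℕ n → ℕ → List (Vec ℕ n)
solutions {n} A k = filter (λ v → dot A v ℕₚ.≟ k) (tuples (downFrom (suc k)) n)

module _ {n} (A : Vector ℕ n) where

  solutions-unique : ∀ k → Unique (solutions A k)
  solutions-unique k = Uniqueₚ.filter⁺ (λ v → dot A v ℕₚ.≟ k) (tuples-unique (Uniqueₚ.downFrom⁺ (suc k)) n)

  ∈-solutions⁻ : ∀ k {v} → v ∈ solutions A k → dot A v ≡ k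
  ∈-solutions⁻ k p = proj₂ (∈-filter⁻ (λ v → dot A v ℕₚ.≟ k) {xs = tuples (downFrom (suc k)) n} p)

  ∈-solutions⁺ : (∀ i → 0 < A i) → ∀ k {v} → dot A v ≡ k → v ∈ solutions A k
  ∈-solutions⁺ p k {v} eq = ∈-filter⁺ (λ v → dot A v ℕₚ.≟ k)
    (∈-tuples⁺ _ v (λ i → ∈-downFrom⁺ (s≤s (≡.subst (Vec.lookup v i ≤_) eq (lookup≤dot p v i))))) eq

incHead : ∀ {n} → Vec ℕ (suc n) → Vec ℕ (suc n)
incHead (x ∷ v) = suc x ∷ v

incHead-injective : ∀ {n} {v w : Vec ℕ (suc n)} → incHead v ≡ incHead w → v ≡ w
incHead-injective {v = _ ∷ _} {_ ∷ _} ≡.refl = ≡.refl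

dot-0∷ : ∀ {n} (A : Vector ℕ (suc n)) v → dot A (0 ∷ v) ≡ dot (A ∘ suc) v
dot-0∷ A v = ≡.cong (ℕ._+ dot (A ∘ suc) v) (ℕₚ.*-zeroʳ (A zero))

dot-incHead : ∀ {n} (A : Vector ℕ (suc n)) v → dot A (incHead v) ≡ A zero ℕ.+ dot A v
dot-incHead A (x ∷ v) = ≡.trans (≡.cong (ℕ._+ dot (A ∘ suc) v) (ℕₚ.*-suc (A zero) x)) (ℕₚ.+-assoc (A zero) _ _)

-- A first entry is either zero or can be lowered by one, which takes `A zero` off the total. This
-- is the geometric series recursion w = w′ + x w at the level of lists, with the shift standing for
-- multiplication by the power of t in x.
solutions-rec : ∀ {n} (A : Vector ℕ (suc n)) → (∀ i → 0 < A i) → ∀ k →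
  solutions A k ↭ map (0 ∷_) (solutions (A ∘ suc) k) ++ map incHead (shift [] (A zero) (solutions A) k)
solutions-rec {n} A p k = unique∧set⇒↭ (solutions-unique A k)
  (Uniqueₚ.++⁺
    (Uniqueₚ.map⁺ (λ { ≡.refl → ≡.refl }) (solutions-unique (A ∘ suc) k))
    (Uniqueₚ.map⁺ incHead-injective (shift-unique (A zero) (solutions A) (solutions-unique A) k))
    λ { (l , r) → disjoint (∈-map⁻ _ l) (∈-map⁻ _ r) })
  to from
  where
  disjoint : ∀ {v : Vec ℕ (suc n)} {P : Vec ℕ n → Set} {Q : Vec ℕ (suc n) → Set} →
    (∃ λ x → P x × v ≡ 0 ∷ x) → (∃ λ x → Q x × v ≡ incHead x) → ⊥
  disjoint (_ , _ , ≡.refl) (_ ∷ _ , _ , ())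

  to : ∀ {v} → v ∈ solutions A k → v ∈ map (0 ∷_) (solutions (A ∘ suc) k) ++ map incHead (shift [] (A zero) (solutions A) k)
  to {zero ∷ v} v∈ = ∈-++⁺ˡ (∈-map⁺ (0 ∷_) (∈-solutions⁺ (A ∘ suc) (p ∘ suc) k
    (≡.trans (≡.sym (dot-0∷ A v)) (∈-solutions⁻ A k v∈))))
  to {suc x ∷ v} v∈ = ∈-++⁺ʳ _ (∈-map⁺ incHead (≡.subst (λ j → (x ∷ v) ∈ shift [] (A zero) (solutions A) j)
    (≡.trans (≡.sym (dot-incHead A (x ∷ v))) (∈-solutions⁻ A k v∈))
    (∈-shift⁺ (A zero) (solutions A) (∈-solutions⁺ A p _ ≡.refl))))

  from : ∀ {v} → v ∈ map (0 ∷_) (solutions (A ∘ suc) k) ++ map incHead (shift [] (A zero) (solutions A) k) → v ∈ solutions A k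
  from v∈ with ∈-++⁻ (map (0 ∷_) (solutions (A ∘ suc) k)) v∈
  ... | inj₁ l with w , w∈ , ≡.refl ← ∈-map⁻ _ l =
    ∈-solutions⁺ A p k (≡.trans (dot-0∷ A w) (∈-solutions⁻ (A ∘ suc) k w∈))
  ... | inj₂ r with w , w∈ , ≡.refl ← ∈-map⁻ _ r
               with j , k≡ , w∈′ ← ∈-shift⁻ (A zero) (solutions A) k w∈ =
    ∈-solutions⁺ A p k (≡.trans (dot-incHead A w) (≡.trans (≡.cong (A zero ℕ.+_) (∈-solutions⁻ A j w∈′)) (≡.sym k≡)))

module GeometricProducts {c ℓ} (R : CommutativeRing c ℓ) where
  open CommutativeRing R hiding (_-_)
  open RingOps rawRing using (_-_)
  open import Algebra.Properties.Ring ring using (-‿distribˡ-*)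
  open SetoidReasoning setoid

  1-x-solves : ∀ {x w w′} → w ≈ w′ + x * w → (1# - x) * w ≈ w′
  1-x-solves {x} {w} {w′} eq = begin
    (1# - x) * w           ≈⟨ distribʳ w 1# (- x) ⟩
    1# * w + - x * w       ≈⟨ +-cong (*-identityˡ w) (sym (-‿distribˡ-* x w)) ⟩
    w - x * w              ≈⟨ +-congʳ eq ⟩
    w′ + x * w - x * w     ≈⟨ +-assoc _ _ _ ⟩
    w′ + (x * w - x * w)   ≈⟨ +-congˡ (-‿inverseʳ _) ⟩
    w′ + 0#                ≈⟨ +-identityʳ w′ ⟩
    w′                     ∎

  cancel-step : ∀ {f p w w′} → f * w ≈ w′ → p * w′ ≈ 1# → (f * p) * w ≈ 1#
  cancel-step {f} {p} {w} {w′} eq eq′ = begin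
    (f * p) * w  ≈⟨ *-congʳ (*-comm f p) ⟩
    (p * f) * w  ≈⟨ *-assoc p f w ⟩
    p * (f * w)  ≈⟨ *-congˡ eq ⟩
    p * w′       ≈⟨ eq′ ⟩
    1#           ∎

  -- Allows the recursively defined inverse to be exchanged for any explicit solution.
  inverse-unique : ∀ {d w v} n → d * w ≈ 1# → d * v ≈ 1# → n * w ≈ n * v
  inverse-unique {d} {w} {v} n p p′ = *-congˡ (begin
    w            ≈⟨ *-identityʳ w ⟨
    w * 1#       ≈⟨ *-congˡ p′ ⟨
    w * (d * v)  ≈⟨ *-assoc w d v ⟨
    w * d * v    ≈⟨ *-congʳ (*-comm w d) ⟩
    d * w * v    ≈⟨ *-congʳ p ⟩
    1# * v       ≈⟨ *-identityˡ v ⟩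
    v            ∎)

module Denominators {c ℓ} (R : CommutativeRing c ℓ) (q a : CommutativeRing.Carrier R) where
  open CommutativeRing R hiding (zero)
  open PowerSeries rawRing using (Series; const; var; _⊗_; inverse) renaming (_÷_ to _÷ₛ_)
  open SeriesRing R
  open Monomials R
  open ListSums R
  open import Algebra.Properties.Semiring.Exp semiring using (^-homo-*)
  private
    module S = CommutativeRing seriesRing
    module T = RingOps (PowerSeries.rawRing rawRing)
    module GP = GeometricProducts seriesRing
  open RingOps rawRing using (_^_)
  open SetoidReasoning setoid

  monomial : ℕ → ℕ → Series
  monomial i j = (var T.^ i) ⊗ (const q T.^ j)

  monomial-⊗ : ∀ i j f → monomial i j ⊗ f ≐ shift 0# i (λ k → q ^ j * f k)
  monomial-⊗ i j f n = begin
    (monomial i j ⊗ f) n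
      ≈⟨ ⊗-assoc (var T.^ i) (const q T.^ j) f n ⟩
    ((var T.^ i) ⊗ ((const q T.^ j) ⊗ f)) n
      ≈⟨ var^-⊗ i ((const q T.^ j) ⊗ f) n ⟩
    shift 0# i ((const q T.^ j) ⊗ f) n
      ≈⟨ shift-cong i (λ k → trans (⊗-cong {const q T.^ j} {const (q ^ j)} {f} {f} (const-^ q j) (λ _ → refl) k)
                                   (const-⊗ (q ^ j) f k)) n ⟩
    shift 0# i (λ k → q ^ j * f k) n ∎

  factor : ∀ {n} → Vector ℕ n → Vector ℕ n → Fin n → Series
  factor A B i = T.1# T.- monomial (A i) (B i)

  -- The product of the geometric series 1 / (1 - t^(A i) q^(B i)), multiplied out and collected by
  -- powers of t.
  expansion : ∀ {n} → Vector ℕ n → Vector ℕ n → Series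
  expansion A B k = ∑ (λ v → q ^ dot B v) (solutions A k)

  expansion-rec : ∀ {n} (A B : Vector ℕ (suc n)) → (∀ i → 0 < A i) →
    expansion A B ≐ λ k → expansion (A ∘ suc) (B ∘ suc) k + (monomial (A zero) (B zero) ⊗ expansion A B) k
  expansion-rec A B p k = begin
    ∑ u (solutions A k)
      ≈⟨ ∑-↭ u (solutions-rec A p k) ⟩
    ∑ u (map (0 ∷_) (solutions (A ∘ suc) k) ++ map incHead (shift [] (A zero) (solutions A) k))
      ≈⟨ ∑-++ u (map (0 ∷_) (solutions (A ∘ suc) k)) _ ⟩
    ∑ u (map (0 ∷_) (solutions (A ∘ suc) k)) + ∑ u (map incHead (shift [] (A zero) (solutions A) k))
      ≈⟨ +-cong
           (trans (∑-map u (0 ∷_) (solutions (A ∘ suc) k))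
                  (∑-cong (λ v → reflexive (≡.cong (q ^_) (dot-0∷ B v))) (solutions (A ∘ suc) k)))
           (trans (∑-map u incHead (shift [] (A zero) (solutions A) k))
                  (∑-cong (λ v → trans (reflexive (≡.cong (q ^_) (dot-incHead B v))) (^-homo-* q (B zero) (dot B v)))
                          (shift [] (A zero) (solutions A) k))) ⟩
    expansion (A ∘ suc) (B ∘ suc) k + ∑ (λ v → q ^ B zero * u v) (shift [] (A zero) (solutions A) k)
      ≈⟨ +-congˡ (∑-shift (λ v → q ^ B zero * u v) (A zero) (solutions A) k) ⟨
    expansion (A ∘ suc) (B ∘ suc) k + shift 0# (A zero) (λ k → ∑ (λ v → q ^ B zero * u v) (solutions A k)) k
      ≈⟨ +-congˡ (shift-cong (A zero) (λ k → ∑-*ˡ (q ^ B zero) u (solutions A k)) k) ⟨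
    expansion (A ∘ suc) (B ∘ suc) k + shift 0# (A zero) (λ k → q ^ B zero * expansion A B k) k
      ≈⟨ +-congˡ (monomial-⊗ (A zero) (B zero) (expansion A B) k) ⟨
    expansion (A ∘ suc) (B ∘ suc) k + (monomial (A zero) (B zero) ⊗ expansion A B) k ∎
    where
    u : Vec ℕ _ → Carrier
    u v = q ^ dot B v

  expansion-correct : ∀ {n} (A B : Vector ℕ n) → (∀ i → 0 < A i) →
    T.product (factor A B) ⊗ expansion A B S.≈ T.1#
  expansion-correct {zero} A B p = S.trans (S.*-identityˡ (expansion A B)) λ where
    zero    → +-identityʳ _
    (suc k) → refl
  expansion-correct {suc n} A B p = GP.cancel-step
    {factor A B zero} {T.product (factor A B ∘ suc)} {expansion A B} {expansion (A ∘ suc) (B ∘ suc)}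
    (GP.1-x-solves {monomial (A zero) (B zero)} {expansion A B} {expansion (A ∘ suc) (B ∘ suc)} (expansion-rec A B p))
    (expansion-correct (A ∘ suc) (B ∘ suc) (p ∘ suc))

  factor-0 : ∀ {n} (A B : Vector ℕ n) i → 0 < A i → factor A B i 0 ≈ 1#
  factor-0 A B i p with A i
  ... | suc A′ = begin
    1# + - monomial (suc A′) (B i) 0    ≈⟨ +-congˡ (-‿cong (var^-⊗ (suc A′) (const q T.^ B i) 0)) ⟩
    1# + - 0#                           ≈⟨ +-congˡ -0#≈0# ⟩
    1# + 0#                             ≈⟨ +-identityʳ _ ⟩
    1#                                  ∎
    where open import Algebra.Properties.Ring ring using (-0#≈0#)

  product-0 : ∀ {n} (f : Fin n → Series) → (∀ i → f i 0 ≈ 1#) → T.product f 0 ≈ 1#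
  product-0 {zero}  f p = refl
  product-0 {suc n} f p = trans (+-identityʳ _)
    (trans (*-cong (p zero) (product-0 (f ∘ suc) (p ∘ suc))) (*-identityʳ _))

  -- Positivity of `A` is used twice: it makes `expansion` a reciprocal of the product, and it gives
  -- `D` the constant coefficient 1 that `inverse-correct` requires.
  ÷-expansion : ∀ {n} (A B : Vector ℕ n) → (∀ i → 0 < A i) → ∀ N D →
    D S.≈ T.product (factor A B) → N ⊗ expansion A B S.≈ N ÷ₛ D
  ÷-expansion A B p N D eq = GP.inverse-unique {D} {expansion A B} {inverse D} N
    (S.trans (S.*-congʳ {expansion A B} {D} {T.product (factor A B)} eq) (expansion-correct A B p))
    (inverse-correct ring D
      (trans (eq 0) (product-0 (factor A B) (λ i → factor-0 A B i (p i)))))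

  -- Multiplying by t^(d g) delays the solution list of g by `d g`, so the coefficient of t^k runs
  -- over the pairs (g , v) with d g + dot A v = k.
  numerator-expansion : ∀ {x} {X : Set x} {n} (A B : Vector ℕ n) (d f e : X → ℕ) xs →
    (List.foldr T._+_ T.0# (map (λ g → monomial (d g) (f g) ⊗ (const a T.^ e g)) xs) ⊗ expansion A B) ≐
    λ k → ∑ (λ g → ∑ (λ v → q ^ (f g ℕ.+ dot B v) * a ^ e g) (shift [] (d g) (solutions A) k)) xs
  numerator-expansion A B d f e [] k = S.zeroˡ (expansion A B) k
  numerator-expansion A B d f e (g ∷ xs) k = trans
    (⊗-distribʳ (term g) (List.foldr T._+_ T.0# (map term xs)) (expansion A B) k)
    (+-cong term-expansion (numerator-expansion A B d f e xs k))
    where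
    term : _ → Series
    term g = monomial (d g) (f g) ⊗ (const a T.^ e g)

    term-expansion : ((monomial (d g) (f g) ⊗ (const a T.^ e g)) ⊗ expansion A B) k ≈
           ∑ (λ v → q ^ (f g ℕ.+ dot B v) * a ^ e g) (shift [] (d g) (solutions A) k)
    term-expansion = begin
      ((monomial (d g) (f g) ⊗ (const a T.^ e g)) ⊗ expansion A B) k
        ≈⟨ ⊗-assoc (monomial (d g) (f g)) (const a T.^ e g) (expansion A B) k ⟩
      (monomial (d g) (f g) ⊗ ((const a T.^ e g) ⊗ expansion A B)) k
        ≈⟨ monomial-⊗ (d g) (f g) ((const a T.^ e g) ⊗ expansion A B) k ⟩
      shift 0# (d g) (λ k → q ^ f g * ((const a T.^ e g) ⊗ expansion A B) k) k
        ≈⟨ shift-cong (d g) coeff k ⟩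
      shift 0# (d g) (λ k → ∑ (λ v → q ^ (f g ℕ.+ dot B v) * a ^ e g) (solutions A k)) k
        ≈⟨ ∑-shift _ (d g) (solutions A) k ⟩
      ∑ (λ v → q ^ (f g ℕ.+ dot B v) * a ^ e g) (shift [] (d g) (solutions A) k) ∎
      where
      coeff : ∀ k → q ^ f g * ((const a T.^ e g) ⊗ expansion A B) k ≈
                    ∑ (λ v → q ^ (f g ℕ.+ dot B v) * a ^ e g) (solutions A k)
      coeff k = begin
        q ^ f g * ((const a T.^ e g) ⊗ expansion A B) k
          ≈⟨ *-congˡ (⊗-cong {const a T.^ e g} {const (a ^ e g)} {expansion A B} {expansion A B}
                             (const-^ a (e g)) (λ _ → refl) k) ⟩
        q ^ f g * (const (a ^ e g) ⊗ expansion A B) k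
          ≈⟨ *-congˡ (const-⊗ (a ^ e g) (expansion A B) k) ⟩
        q ^ f g * (a ^ e g * expansion A B k)
          ≈⟨ *-assoc _ _ _ ⟨
        q ^ f g * a ^ e g * expansion A B k
          ≈⟨ ∑-*ˡ (q ^ f g * a ^ e g) _ (solutions A k) ⟩
        ∑ (λ v → q ^ f g * a ^ e g * q ^ dot B v) (solutions A k)
          ≈⟨ ∑-cong (λ v → trans (xy∙z≈xz∙y _ _ _) (*-congʳ (sym (^-homo-* q (f g) (dot B v))))) (solutions A k) ⟩
        ∑ (λ v → q ^ (f g ℕ.+ dot B v) * a ^ e g) (solutions A k) ∎
        where
        open import Algebra.Properties.CommutativeSemigroup *-commutativeSemigroup using (xy∙z≈xz∙y)

-- Selecting degrees divisible by p

module Homogeneous {c ℓ} (R : CommutativeRing c ℓ) where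
  open CommutativeRing R hiding (zero)
  open PowerSeries rawRing using (Series; const; var; _⊗_)
  open SeriesRing R
  open Monomials R
  open ListSums seriesRing
  private
    module T = RingOps (PowerSeries.rawRing rawRing)
  open RingOps rawRing using (_^_)

  shift-const-≢ : ∀ x i j → j ≢ i → shift 0# i (const x) j ≈ 0#
  shift-const-≢ x zero    zero    j≢i = contradiction ≡.refl j≢i
  shift-const-≢ x zero    (suc j) j≢i = refl
  shift-const-≢ x (suc i) zero    j≢i = refl
  shift-const-≢ x (suc i) (suc j) j≢i = shift-const-≢ x i j (j≢i ∘ ≡.cong suc)

  var^-const^-≢ : ∀ i x k j → j ≢ i → ((var T.^ i) ⊗ (const x T.^ k)) j ≈ 0#
  var^-const^-≢ i x k j j≢i = trans (var^-⊗ i (const x T.^ k) j)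
    (trans (shift-cong i (const-^ x k) j) (shift-const-≢ (x ^ k) i j j≢i))

  module _ {x} {X : Set x} (deg : X → ℕ) (f : X → Series)
    (homogeneous : ∀ x j → j ≢ deg x → f x j ≈ 0#) (p : ℕ) where

    -- Each `f x` lives in the single degree `deg x`, so discarding coefficients amounts to
    -- discarding summands. In `∑-filter-∤` no surviving summand can have degree j.
    ∑-filter-∣ : ∀ xs j → p ∣ j → ∑ f xs j ≈ ∑ f (filter (λ x → p ∣? deg x) xs) j
    ∑-filter-∣ []       j p∣j = refl
    ∑-filter-∣ (x ∷ xs) j p∣j with p ∣? deg x
    ... | yes _   = +-congˡ (∑-filter-∣ xs j p∣j)
    ... | no  p∤x = trans (+-cong (homogeneous x j λ { ≡.refl → p∤x p∣j }) (∑-filter-∣ xs j p∣j)) (+-identityˡ _)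

    ∑-filter-∤ : ∀ xs j → ¬ p ∣ j → 0# ≈ ∑ f (filter (λ x → p ∣? deg x) xs) j
    ∑-filter-∤ []       j p∤j = refl
    ∑-filter-∤ (x ∷ xs) j p∤j with p ∣? deg x
    ... | no  _   = ∑-filter-∤ xs j p∤j
    ... | yes p∣x = trans (∑-filter-∤ xs j p∤j)
      (sym (trans (+-congʳ (homogeneous x j λ { ≡.refl → p∤j p∣x })) (+-identityˡ _)))

-- Words and coloured permutations

module Combinatorics where

  open import Data.Nat.Base using (_+_; _*_)
  open import Relation.Binary.PropositionalEquality
    using (refl; sym; trans; cong; cong₂; subst; subst₂; _≗_; module ≡-Reasoning)
  open import Algebra.Properties.Semiring.Sum ℕₚ.+-*-semiring
    using (sum; sum-cong-≗; ∑-distrib-+; *-distribˡ-sum; sum-permute)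

  -- Suffix sums

  infix 4 _⋖_
  _⋖_ : ∀ {n} → Fin n → Fin n → Set
  i ⋖ j = toℕ j ≡ suc (toℕ i)

  -- The statistics h, k and λ and the sorted letters of a word are all of this form, so they can be
  -- compared and added through their differences.
  suffixSums : ∀ {n} → Vector ℕ n → Vector ℕ n
  suffixSums {suc n} y zero    = sum y
  suffixSums {suc n} y (suc i) = suffixSums (y ∘ suc) i

  suffixSums-cong : ∀ {n} {y y′ : Vector ℕ n} → y ≗ y′ → suffixSums y ≗ suffixSums y′
  suffixSums-cong {suc n} eq zero    = sum-cong-≗ eq
  suffixSums-cong {suc n} eq (suc i) = suffixSums-cong (eq ∘ suc) i

  suffixSums-+ : ∀ {n} (y z : Vector ℕ n) i →
    suffixSums (λ j → y j + z j) i ≡ suffixSums y i + suffixSums z i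
  suffixSums-+ {suc n} y z zero    = ∑-distrib-+ y z
  suffixSums-+ {suc n} y z (suc i) = suffixSums-+ (y ∘ suc) (z ∘ suc) i

  suffixSums-* : ∀ {n} k (y : Vector ℕ n) i → suffixSums (λ j → k * y j) i ≡ k * suffixSums y i
  suffixSums-* {suc n} k y zero    = sym (*-distribˡ-sum k y)
  suffixSums-* {suc n} k y (suc i) = suffixSums-* k (y ∘ suc) i

  suffixSums-⋖ : ∀ {n} (y : Vector ℕ n) {i j} → i ⋖ j → suffixSums y i ≡ y i + suffixSums y j
  suffixSums-⋖ y {zero}  {suc zero} eq = refl
  suffixSums-⋖ y {suc i} {suc j}    eq = suffixSums-⋖ (y ∘ suc) (ℕₚ.suc-injective eq)

  suffixSums≤sum : ∀ {n} (y : Vector ℕ n) i → suffixSums y i ≤ sum y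
  suffixSums≤sum y zero    = ℕₚ.≤-refl
  suffixSums≤sum y (suc i) = ℕₚ.≤-trans (suffixSums≤sum (y ∘ suc) i) (ℕₚ.m≤n+m _ (y zero))

  -- Double counting: an entry belongs to the suffixes that start at its own position or earlier.
  -- This is the source of the factor i in the exponents i r and n m of q.
  sum-suffixSums : ∀ {n} (y : Vector ℕ n) → sum (suffixSums y) ≡ sum (λ i → suc (toℕ i) * y i)
  sum-suffixSums {zero}  y = refl
  sum-suffixSums {suc n} y = begin
    y zero + sum (y ∘ suc) + sum (suffixSums (y ∘ suc))
      ≡⟨ cong (y zero + sum (y ∘ suc) +_) (sum-suffixSums (y ∘ suc)) ⟩
    y zero + sum (y ∘ suc) + sum (λ i → suc (toℕ i) * y (suc i))
      ≡⟨ ℕₚ.+-assoc (y zero) _ _ ⟩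
    y zero + (sum (y ∘ suc) + sum (λ i → suc (toℕ i) * y (suc i)))
      ≡⟨ cong (y zero +_) (∑-distrib-+ (y ∘ suc) _) ⟨
    y zero + sum (λ i → suc (suc (toℕ i)) * y (suc i))
      ≡⟨ cong (_+ sum (λ i → suc (suc (toℕ i)) * y (suc i))) (ℕₚ.*-identityˡ (y zero)) ⟨
    sum (λ i → suc (toℕ i) * y i) ∎
    where open ≡-Reasoning

  suffixSums-injective : ∀ {n} {y y′ : Vector ℕ n} → suffixSums y ≗ suffixSums y′ → y ≗ y′
  suffixSums-injective {suc n} {y} {y′} eq zero = ℕₚ.+-cancelʳ-≡ (sum (y ∘ suc)) _ _
    (trans (eq zero) (cong (y′ zero +_) (sum-cong-≗ (λ i → sym (suffixSums-injective (eq ∘ suc) i)))))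
  suffixSums-injective eq (suc i) = suffixSums-injective (eq ∘ suc) i

  suffixSums-surjective : ∀ {n} (x : Vector ℕ n) → (∀ {i j} → i ⋖ j → x j ≤ x i) →
    ∃ λ y → suffixSums y ≗ x
  suffixSums-surjective {zero} x anti = x , λ ()
  suffixSums-surjective {suc zero} x anti = x , λ { zero → ℕₚ.+-identityʳ (x zero) }
  suffixSums-surjective {suc (suc n)} x anti
    with y , eq ← suffixSums-surjective (x ∘ suc) (λ i⋖j → anti (cong suc i⋖j)) = y′ , λ where
      zero    → trans (cong (x zero ∸ x (suc zero) +_) (eq zero)) (ℕₚ.m∸n+n≡m (anti refl))
      (suc i) → eq i
    where
    y′ : Vector ℕ (suc (suc n))
    y′ zero    = x zero ∸ x (suc zero)
    y′ (suc i) = y i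

  ⋖⇒< : ∀ {n ℓ} {R : Fin n → Fin n → Set ℓ} → (∀ {i j k} → R i j → R j k → R i k) →
    (∀ {i j} → i ⋖ j → R i j) → ∀ {i j} → i Fin.< j → R i j
  ⋖⇒< {n} {R = R} R-trans step {i} {j} i<j =
    go (toℕ j ∸ suc (toℕ i)) i (ℕₚ.m∸n+n≡m i<j)
    where
    go : ∀ k i → k + suc (toℕ i) ≡ toℕ j → R i j
    go zero    i eq = step (sym eq)
    go (suc k) i eq = R-trans (step i⋖i′) (go k i′ (trans (cong (λ l → k + suc l) i⋖i′) (trans (ℕₚ.+-suc k _) eq)))
      where
      i+1<n : suc (toℕ i) < n
      i+1<n = ℕₚ.≤-<-trans (ℕₚ.≤-trans (ℕₚ.m≤n+m _ (suc k)) (ℕₚ.≤-reflexive eq)) (Finₚ.toℕ<n j)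
      i′ = fromℕ< i+1<n
      i⋖i′ : i ⋖ i′
      i⋖i′ = Finₚ.toℕ-fromℕ< i+1<n

  -- Sorting the positions of a word

  infix 4 _⊢_≺_
  _⊢_≺_ : ∀ {n} → Vector ℕ n → Fin n → Fin n → Set
  f ⊢ u ≺ v = f v < f u ⊎ (f u ≡ f v × u Fin.< v)

  -- Only neighbours are compared, because the differences of consecutive letters control just
  -- these; transitivity and `⋖⇒<` give the remaining pairs.
  Sorts : ∀ {n} → Permutation′ n → Vector ℕ n → Set
  Sorts π f = ∀ {i j} → i ⋖ j → f ⊢ π ⟨$⟩ʳ i ≺ π ⟨$⟩ʳ j

  module _ {n} {f : Vector ℕ n} where

    ≺-trans : ∀ {u v w} → f ⊢ u ≺ v → f ⊢ v ≺ w → f ⊢ u ≺ w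
    ≺-trans {u} {v} {w} (inj₁ p)        (inj₁ q)         = inj₁ (ℕₚ.<-trans q p)
    ≺-trans {u} {v} {w} (inj₁ p)        (inj₂ (eq , q))  = inj₁ (subst (_< f u) eq p)
    ≺-trans {u} {v} {w} (inj₂ (eq , p)) (inj₁ q)         = inj₁ (subst (f w <_) (sym eq) q)
    ≺-trans {u} {v} {w} (inj₂ (eq , p)) (inj₂ (eq′ , q)) = inj₂ (trans eq eq′ , Finₚ.<-trans p q)

    ≺-irrefl : ∀ {u} → ¬ f ⊢ u ≺ u
    ≺-irrefl (inj₁ p)       = ℕₚ.<-irrefl refl p
    ≺-irrefl (inj₂ (_ , p)) = ℕₚ.<-irrefl refl p

    ≺⇒≥ : ∀ {u v} → f ⊢ u ≺ v → f v ≤ f u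
    ≺⇒≥ (inj₁ p)        = ℕₚ.<⇒≤ p
    ≺⇒≥ (inj₂ (eq , _)) = ℕₚ.≤-reflexive (sym eq)

  ≺-first : ∀ {n} (f : Vector ℕ (suc n)) → ∃ λ u → ∀ v → v ≢ u → f ⊢ u ≺ v
  ≺-first {zero}  f = zero , λ { zero v≢u → contradiction refl v≢u }
  ≺-first {suc n} f with u , first ← ≺-first (f ∘ suc) with f (suc u) ℕₚ.≤? f zero
  ... | yes u≤0 = zero , λ { zero 0≢0 → contradiction refl 0≢0 ; (suc v) _ → before v }
    where
    0≺u : f ⊢ zero ≺ suc u
    0≺u with ℕₚ.m≤n⇒m<n∨m≡n u≤0
    ... | inj₁ u<0 = inj₁ u<0
    ... | inj₂ u≡0 = inj₂ (sym u≡0 , s≤s z≤n)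
    before : ∀ v → f ⊢ zero ≺ suc v
    before v with v Finₚ.≟ u
    ... | yes refl = 0≺u
    ... | no  v≢u with first v v≢u
    ...   | inj₁ p        = ≺-trans {f = f} {zero} {suc u} {suc v} 0≺u (inj₁ p)
    ...   | inj₂ (eq , p) = ≺-trans {f = f} {zero} {suc u} {suc v} 0≺u (inj₂ (eq , s≤s p))
  ... | no u≰0 = suc u , λ
    { zero    _     → inj₁ (ℕₚ.≰⇒> u≰0)
    ; (suc v) sv≢su → case-suc (first v (sv≢su ∘ cong suc))
    }
    where
    case-suc : ∀ {v} → f ∘ suc ⊢ u ≺ v → f ⊢ suc u ≺ suc v
    case-suc (inj₁ p)        = inj₁ p
    case-suc (inj₂ (eq , p)) = inj₂ (eq , s≤s p)

  -- Selection sort: the position that precedes all others goes to the front, and the rest is sorted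
  -- through `punchIn`, which is strictly increasing and so respects the order of ties.
  sort : ∀ {n} (f : Vector ℕ n) → ∃ λ π → Sorts π f
  sort {zero}  f = Perm.id , λ { {()} }
  sort {suc n} f with u , first ← ≺-first f with π , sorts ← sort (f ∘ punchIn u) =
    Perm.insert zero u π , step
    where
    lift : ∀ {v w} → f ∘ punchIn u ⊢ v ≺ w → f ⊢ punchIn u v ≺ punchIn u w
    lift (inj₁ p)        = inj₁ p
    lift (inj₂ (eq , p)) = inj₂ (eq , Finₚ.≤∧≢⇒< (Finₚ.punchIn-mono-≤ u _ _ (ℕₚ.<⇒≤ p))
      (λ eq → Finₚ.<⇒≢ p (Finₚ.punchIn-injective u _ _ eq)))
    step : Sorts (Perm.insert zero u π) f
    step {zero}  {suc j} eq = first _ (Finₚ.punchInᵢ≢i u _)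
    step {suc i} {suc j} eq = lift (sorts (ℕₚ.suc-injective eq))

  strictlyMonotone⇒inflationary : ∀ {n} (ρ : Fin n → Fin n) →
    (∀ {i j} → i Fin.< j → ρ i Fin.< ρ j) → ∀ i → i Fin.≤ ρ i
  strictlyMonotone⇒inflationary {n} ρ mono i = go (toℕ i) i refl
    where
    go : ∀ k i → toℕ i ≡ k → k ≤ toℕ (ρ i)
    go zero    i eq = z≤n
    go (suc k) i eq = ℕₚ.≤-<-trans (go k i′ toℕ-i′) (mono (ℕₚ.≤-reflexive (trans (cong suc toℕ-i′) (sym eq))))
      where
      k<n : k < n
      k<n = ℕₚ.<-trans (ℕₚ.≤-reflexive (sym eq)) (Finₚ.toℕ<n i)
      i′ = fromℕ< k<n
      toℕ-i′ = Finₚ.toℕ-fromℕ< k<n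

  -- Both ρ⁻¹π and its inverse are strictly increasing. A strictly increasing self-map of `Fin n`
  -- never goes below the identity, so both are the identity.
  sort-unique : ∀ {n} {f : Vector ℕ n} (π ρ : Permutation′ n) → Sorts π f → Sorts ρ f → π Perm.≈ ρ
  sort-unique {n} {f} π ρ π-sorts ρ-sorts k = trans (sym (Perm.inverseʳ ρ)) (cong (ρ ⟨$⟩ʳ_) ρ⁻¹πk≡k)
    where
    monotone : ∀ (π ρ : Permutation′ n) → Sorts π f → Sorts ρ f →
      ∀ {i j} → i Fin.< j → ρ ⟨$⟩ˡ (π ⟨$⟩ʳ i) Fin.< ρ ⟨$⟩ˡ (π ⟨$⟩ʳ j)
    monotone π ρ π-sorts ρ-sorts {i} {j} i<j with Finₚ.<-cmp (ρ ⟨$⟩ˡ (π ⟨$⟩ʳ i)) (ρ ⟨$⟩ˡ (π ⟨$⟩ʳ j))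
    ... | tri< lt _ _ = lt
    ... | tri≈ _ eq _ = contradiction (subst (f ⊢ π ⟨$⟩ʳ i ≺_) (sym πi≡πj) πi≺πj) (≺-irrefl {f = f} {π ⟨$⟩ʳ i})
      where
      πi≺πj = ⋖⇒< {R = λ i j → f ⊢ π ⟨$⟩ʳ i ≺ π ⟨$⟩ʳ j} (≺-trans {f = f}) π-sorts i<j
      πi≡πj : π ⟨$⟩ʳ i ≡ π ⟨$⟩ʳ j
      πi≡πj = trans (sym (Perm.inverseʳ ρ)) (trans (cong (ρ ⟨$⟩ʳ_) eq) (Perm.inverseʳ ρ))
    ... | tri> _ _ gt = contradiction (≺-trans {f = f} πi≺πj πj≺πi) (≺-irrefl {f = f} {π ⟨$⟩ʳ i})
      where
      πi≺πj = ⋖⇒< {R = λ i j → f ⊢ π ⟨$⟩ʳ i ≺ π ⟨$⟩ʳ j} (≺-trans {f = f}) π-sorts i<j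
      πj≺πi : f ⊢ π ⟨$⟩ʳ j ≺ π ⟨$⟩ʳ i
      πj≺πi = subst₂ (f ⊢_≺_) (Perm.inverseʳ ρ) (Perm.inverseʳ ρ)
        (⋖⇒< {R = λ i j → f ⊢ ρ ⟨$⟩ʳ i ≺ ρ ⟨$⟩ʳ j} (≺-trans {f = f}) ρ-sorts gt)

    ρ⁻¹πk≡k : ρ ⟨$⟩ˡ (π ⟨$⟩ʳ k) ≡ k
    ρ⁻¹πk≡k = Finₚ.≤-antisym
      (subst (ρ ⟨$⟩ˡ (π ⟨$⟩ʳ k) Fin.≤_) (trans (cong (π ⟨$⟩ˡ_) (Perm.inverseʳ ρ)) (Perm.inverseˡ π))
        (strictlyMonotone⇒inflationary _ (monotone ρ π ρ-sorts π-sorts) (ρ ⟨$⟩ˡ (π ⟨$⟩ʳ k))))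
      (strictlyMonotone⇒inflationary _ (monotone π ρ π-sorts ρ-sorts) k)

  -- Congruences modulo r

  module Congruence (r : ℕ) .{{_ : NonZero r}} where

    infix 4 _≡ᵣ_
    _≡ᵣ_ : ℕ → ℕ → Set
    x ≡ᵣ y = x % r ≡ y % r

    +-cong-≡ᵣ : ∀ {x x′ y y′} → x ≡ᵣ x′ → y ≡ᵣ y′ → x + y ≡ᵣ x′ + y′
    +-cong-≡ᵣ {x} {x′} {y} {y′} p q = trans (%-distribˡ-+ x y r)
      (trans (cong₂ (λ u v → (u + v) % r) p q) (sym (%-distribˡ-+ x′ y′ r)))

    +-*r : ∀ x k → x + k * r ≡ᵣ x
    +-*r x k = [m+kn]%n≡m%n x k r

    +-cancelʳ-≡ᵣ : ∀ z {x y} → x + z ≡ᵣ y + z → x ≡ᵣ y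
    +-cancelʳ-≡ᵣ z {x} {y} p = trans (sym (absorb x)) (trans (+-cong-≡ᵣ p refl) (absorb y))
      where
      -- `z * r ∸ z` is a natural number that represents -z modulo r.
      absorb : ∀ x → x + z + (z * r ∸ z) ≡ᵣ x
      absorb x = trans (cong (_% r) (trans (ℕₚ.+-assoc x z _) (cong (x +_) (ℕₚ.m+[n∸m]≡n (ℕₚ.m≤m*n z r))))) (+-*r x z)

    sum-cong-≡ᵣ : ∀ {n} {x y : Vector ℕ n} → (∀ i → x i ≡ᵣ y i) → sum x ≡ᵣ sum y
    sum-cong-≡ᵣ {zero}  p = refl
    sum-cong-≡ᵣ {suc n} p = +-cong-≡ᵣ (p zero) (sum-cong-≡ᵣ (p ∘ suc))

    ∣-resp-≡ᵣ : ∀ {p x y} → p ∣ r → x ≡ᵣ y → p ∣ x → p ∣ y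
    ∣-resp-≡ᵣ {p} {x} {y} p∣r eq p∣x = subst (p ∣_) (sym (m≡m%n+[m/n]*n y r))
      (∣m∣n⇒∣m+n (subst (p ∣_) eq (%-presˡ-∣ p∣x p∣r)) (∣n⇒∣m*n (y / r) p∣r))

    Residue-minus : ∀ x y → Residue r (ℤ.+ x ℤ.- ℤ.+ y) + y ≡ᵣ x
    Residue-minus x y = lift (d ℤ./ℕ r) (begin
      ℤ.+ x
        ≡⟨ ℤₚ.+-identityʳ (ℤ.+ x) ⟨
      ℤ.+ x ℤ.+ ℤ.0ℤ
        ≡⟨ cong (λ z → ℤ.+ x ℤ.+ z) (ℤₚ.+-inverseˡ (ℤ.+ y)) ⟨
      ℤ.+ x ℤ.+ (ℤ.- ℤ.+ y ℤ.+ ℤ.+ y)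
        ≡⟨ ℤₚ.+-assoc (ℤ.+ x) (ℤ.- ℤ.+ y) (ℤ.+ y) ⟨
      d ℤ.+ ℤ.+ y
        ≡⟨ cong (ℤ._+ ℤ.+ y) (ℤᵈ.a≡a%ℕn+[a/ℕn]*n d r) ⟩
      ℤ.+ (d ℤ.%ℕ r) ℤ.+ (d ℤ./ℕ r) ℤ.* ℤ.+ r ℤ.+ ℤ.+ y
        ≡⟨ ℤₚ.+-assoc (ℤ.+ (d ℤ.%ℕ r)) ((d ℤ./ℕ r) ℤ.* ℤ.+ r) (ℤ.+ y) ⟩
      ℤ.+ (d ℤ.%ℕ r) ℤ.+ ((d ℤ./ℕ r) ℤ.* ℤ.+ r ℤ.+ ℤ.+ y)
        ≡⟨ cong (λ w → ℤ.+ (d ℤ.%ℕ r) ℤ.+ w) (ℤₚ.+-comm ((d ℤ./ℕ r) ℤ.* ℤ.+ r) (ℤ.+ y)) ⟩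
      ℤ.+ (d ℤ.%ℕ r) ℤ.+ (ℤ.+ y ℤ.+ (d ℤ./ℕ r) ℤ.* ℤ.+ r)
        ≡⟨ ℤₚ.+-assoc (ℤ.+ (d ℤ.%ℕ r)) (ℤ.+ y) ((d ℤ./ℕ r) ℤ.* ℤ.+ r) ⟨
      ℤ.+ (d ℤ.%ℕ r + y) ℤ.+ (d ℤ./ℕ r) ℤ.* ℤ.+ r ∎)
      where
      open ≡-Reasoning
      d = ℤ.+ x ℤ.- ℤ.+ y
      -- The integer quotient k may be negative; its multiple of r is then moved to the other side,
      -- so that an equation between naturals results in either case.
      lift : ∀ {u v} k → ℤ.+ v ≡ ℤ.+ u ℤ.+ k ℤ.* ℤ.+ r → u ≡ᵣ v
      lift {u} {v} (ℤ.+ k) eq = sym (trans (cong (_% r) (ℤₚ.+-injective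
        (trans eq (cong (λ w → ℤ.+ u ℤ.+ w) (sym (ℤₚ.pos-* k r)))))) (+-*r u k))
      lift {u} {v} k@(ℤ.-[1+ j ]) eq = trans (cong (_% r) (ℤₚ.+-injective (begin
        ℤ.+ u
          ≡⟨ ℤₚ.+-identityʳ _ ⟨
        ℤ.+ u ℤ.+ ℤ.0ℤ
          ≡⟨ cong (λ w → ℤ.+ u ℤ.+ w) (ℤₚ.+-inverseʳ (k ℤ.* ℤ.+ r)) ⟨
        ℤ.+ u ℤ.+ (k ℤ.* ℤ.+ r ℤ.- k ℤ.* ℤ.+ r)
          ≡⟨ ℤₚ.+-assoc (ℤ.+ u) (k ℤ.* ℤ.+ r) (ℤ.- (k ℤ.* ℤ.+ r)) ⟨
        ℤ.+ u ℤ.+ k ℤ.* ℤ.+ r ℤ.- k ℤ.* ℤ.+ r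
          ≡⟨ cong₂ ℤ._+_ (sym eq) (ℤₚ.neg-distribˡ-* k (ℤ.+ r)) ⟩
        ℤ.+ v ℤ.+ ℤ.+ suc j ℤ.* ℤ.+ r
          ≡⟨ cong (λ w → ℤ.+ v ℤ.+ w) (ℤₚ.pos-* (suc j) r) ⟨
        ℤ.+ (v + suc j * r) ∎))) (+-*r v (suc j))

  indicator : ∀ {p} {P : Set p} → Dec P → ℕ
  indicator P? = if does P? then 1 else 0

  length-filter-filter : ∀ {n k p q} {P : Pred (Fin n) p} {Q : Pred (Fin n) q}
    (P? : Decidable P) (Q? : Decidable Q) (f : Fin k → Fin n) →
    length (filter Q? (filter P? (tabulate f))) ≡
    sum (λ j → if does (P? (f j)) then indicator (Q? (f j)) else 0)
  length-filter-filter {k = zero}  P? Q? f = refl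
  length-filter-filter {k = suc k} P? Q? f with does (P? (f zero))
  ... | false = length-filter-filter P? Q? (f ∘ suc)
  ... | true with does (Q? (f zero))
  ...   | false = length-filter-filter P? Q? (f ∘ suc)
  ...   | true  = cong suc (length-filter-filter P? Q? (f ∘ suc))

  sum-from : ∀ {n} (b : Fin n → Bool) i →
    sum (λ j → if b j then indicator (i Finₚ.≤? j) else 0) ≡ suffixSums (λ j → if b j then 1 else 0) i
  sum-from b zero = refl
  sum-from {suc n} b (suc i) = cong₂ _+_ (first≡0 (b zero))
    (trans (sum-cong-≗ {n} (pred-≤ i)) (sum-from (b ∘ suc) i))
    where
    first≡0 : ∀ c → (if c then 0 else 0) ≡ 0
    first≡0 true  = refl
    first≡0 false = refl
    pred-≤ : ∀ (i j : Fin n) → (if b (suc j) then indicator (suc i Finₚ.≤? suc j) else 0) ≡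
                               (if b (suc j) then indicator (i Finₚ.≤? j) else 0)
    pred-≤ zero    j = refl
    pred-≤ (suc i) j = refl

  -- For `P? = isHDes? g` the left side is `h g i`, which thereby becomes a suffix sum like kᵢ.
  length-filter-≥ : ∀ {n p} {P : Pred (Fin n) p} (P? : Decidable P) i →
    length (filter (i Finₚ.≤?_) (filter P? (List.allFin n))) ≡ suffixSums (indicator ∘ P?) i
  length-filter-≥ P? i = trans (length-filter-filter P? (i Finₚ.≤?_) id) (sum-from (does ∘ P?) i)

  dot-sum : ∀ {n} (A : Vector ℕ n) v → dot A v ≡ sum (λ i → A i * Vec.lookup v i)
  dot-sum A []      = refl
  dot-sum A (x ∷ v) = cong (A zero * x +_) (dot-sum (A ∘ suc) v)

  sum-tabulate : ∀ {n} (f : Vector ℕ n) → Vec.sum (Vec.tabulate f) ≡ sum f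
  sum-tabulate {zero}  f = refl
  sum-tabulate {suc n} f = cong (f zero +_) (sum-tabulate (f ∘ suc))

  -- The word of a coloured permutation with exponents

  module Encoding (r s : ℕ) .{{_ : NonZero r}} .{{_ : NonZero s}} (s∣r : s ∣ r) where
    open Statistics r s s∣r
    open Congruence r

    m : ℕ
    m = r / s

    instance
      m≢0 : NonZero m
      m≢0 = r/s-nonZero s∣r

    m*s≡r : m * s ≡ r
    m*s≡r = m/n*n≡m s∣r

    %r%m : ∀ x → x % r % m ≡ x % m
    %r%m x = m∣n⇒o%n%m≡o%m m r x (divides s (trans (sym m*s≡r) (ℕₚ.*-comm m s)))

    -- The differences kᵢ - kᵢ₊₁, with kₙ in the last position.
    gap : ∀ {n} → Vector (Fin r) n → Vector ℕ n
    gap {suc zero}    c zero    = Residue m (ℤcolour c zero)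
    gap {suc (suc n)} c zero    = Residue r (ℤcolour c zero ℤ.- ℤcolour c (suc zero))
    gap {suc (suc n)} c (suc i) = gap (Vector.tail c) i

    kOf-gap : ∀ {n} (c : Vector (Fin r) n) i → kOf c i ≡ suffixSums (gap c) i
    kOf-gap {suc zero}    c zero    = sym (ℕₚ.+-identityʳ _)
    kOf-gap {suc (suc n)} c zero    = trans (ℕₚ.+-comm _ (gap c zero))
      (cong (gap c zero +_) (kOf-gap (Vector.tail c) zero))
    kOf-gap {suc (suc n)} c (suc i) = kOf-gap (Vector.tail c) i

    gap-⋖ : ∀ {n} (c : Vector (Fin r) n) {i j} → i ⋖ j →
      gap c i ≡ Residue r (ℤcolour c i ℤ.- ℤcolour c j)
    gap-⋖ {suc (suc n)} c {zero}  {suc zero} eq = refl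
    gap-⋖ {suc (suc n)} c {suc i} {suc j}    eq = gap-⋖ (Vector.tail c) (ℕₚ.suc-injective eq)

    -- The exponents of t in the denominator, other than that of the factor 1 - t.
    step : ∀ {n} → Vector ℕ n
    step {suc zero}    zero    = 1
    step {suc (suc n)} zero    = s
    step {suc (suc n)} (suc i) = step i

    step>0 : ∀ {n} (i : Fin n) → 0 < step i
    step>0 {suc zero}    zero    = s≤s z≤n
    step>0 {suc (suc n)} zero    = ℕ.>-nonZero⁻¹ s
    step>0 {suc (suc n)} (suc i) = step>0 i

    step-⋖ : ∀ {n} {i j : Fin n} → i ⋖ j → step i ≡ s
    step-⋖ {suc (suc n)} {zero}  {suc zero} eq = refl
    step-⋖ {suc (suc n)} {suc i} {suc j}    eq = step-⋖ (ℕₚ.suc-injective eq)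

    m*step≢0 : ∀ {n} (i : Fin n) → NonZero (m * step i)
    m*step≢0 i = ℕₚ.m*n≢0 m (step i) {{m≢0}} {{ℕ.>-nonZero (step>0 i)}}

    -- Modulo r the sequence is the colouring of the z-th translate under the generator of C_s; one
    -- z serves all positions because the generator shifts all colours alike.
    Compatible : ∀ {n} → Vector (Fin r) n → Vector ℕ n → ℕ → Set
    Compatible c x z = ∀ i → x i ≡ᵣ toℕ (c i) + m * z

    -- The shift z originates in the last position, where only the colour modulo m is seen. Before
    -- it, m * step i = r, so a difference is congruent to cᵢ - cᵢ₊₁ modulo r and passes z on
    -- unchanged.
    gap⇒compatible : ∀ {n} (c : Vector (Fin r) n) (y t : Vector ℕ n) →
      (∀ i → y i ≡ gap c i + m * step i * t i) → ∃ (Compatible c (suffixSums y))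
    gap⇒compatible {zero} c y t eq = 0 , λ ()
    gap⇒compatible {suc zero} c y t eq = z , λ
      { zero → sym (trans (cong (_% r) exact) (+-*r (y zero + 0) (C / m))) }
      where
      C = toℕ (c zero)
      -- C exceeds its residue by (C / m) m; adding s - 1 further copies completes this to a
      -- multiple of r.
      z = t zero + ℕ.pred s * (C / m)
      exact : C + m * z ≡ y zero + 0 + C / m * r
      exact = begin
        C + m * z
          ≡⟨ cong (_+ m * z) (m≡m%n+[m/n]*n C m) ⟩
        C % m + C / m * m + m * z
          ≡⟨ +-*-Solver.solve 5 (λ R Q m t p →
               R :+ Q :* m :+ m :* (t :+ p :* Q) :=
               (R :+ m :* con 1 :* t :+ con 0) :+ Q :* (m :* (con 1 :+ p)))
               refl (C % m) (C / m) m (t zero) (ℕ.pred s) ⟩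
        C % m + m * 1 * t zero + 0 + C / m * (m * suc (ℕ.pred s))
          ≡⟨ cong₂ (λ u v → u + 0 + C / m * (m * v)) (sym (eq zero)) (ℕₚ.suc-pred s) ⟩
        y zero + 0 + C / m * (m * s)
          ≡⟨ cong (λ u → y zero + 0 + C / m * u) m*s≡r ⟩
        y zero + 0 + C / m * r ∎
        where
        open ≡-Reasoning
        open +-*-Solver using (_:+_; _:*_; _:=_; con)
    gap⇒compatible {suc (suc n)} c y t eq
      with z , compat ← gap⇒compatible (Vector.tail c) (y ∘ suc) (t ∘ suc) (eq ∘ suc) = z , λ
        { zero    → sum≡ᵣ z compat
        ; (suc i) → compat i
        }
      where
      C₀ = toℕ (c zero)
      C₁ = toℕ (c (suc zero))
      sum≡ᵣ : ∀ z → Compatible (Vector.tail c) (suffixSums (y ∘ suc)) z → sum y ≡ᵣ C₀ + m * z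
      sum≡ᵣ z compat = begin
        (y zero + sum (y ∘ suc)) % r
          ≡⟨ +-cong-≡ᵣ {y zero} {gap c zero} y₀≡gap (compat zero) ⟩
        (gap c zero + (C₁ + m * z)) % r
          ≡⟨ cong (_% r) (ℕₚ.+-assoc (gap c zero) C₁ (m * z)) ⟨
        (gap c zero + C₁ + m * z) % r
          ≡⟨ +-cong-≡ᵣ {gap c zero + C₁} {C₀} (Residue-minus C₀ C₁) refl ⟩
        (C₀ + m * z) % r ∎
        where
        open ≡-Reasoning
        y₀≡gap : y zero ≡ᵣ gap c zero
        y₀≡gap = trans (cong (_% r) (trans (eq zero) (cong (gap c zero +_)
          (trans (cong (_* t zero) m*s≡r) (ℕₚ.*-comm r (t zero)))))) (+-*r (gap c zero) (t zero))

    -- The shift cancels between neighbours, so the gap is the remainder of the difference modulo r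
    -- and t its quotient. In the last position the shift disappears only modulo m, and the division
    -- is by m.
    compatible⇒gap : ∀ {n} (c : Vector (Fin r) n) (y : Vector ℕ n) z → Compatible c (suffixSums y) z →
      ∃ λ (t : Vector ℕ n) → ∀ i → y i ≡ gap c i + m * step i * t i
    compatible⇒gap {zero} c y z compat = y , λ ()
    compatible⇒gap {suc zero} c y z compat = (λ _ → y zero / m) , λ
        { zero → trans (m≡m%n+[m/n]*n (y zero) m)
            (cong₂ _+_ y%m≡ (trans (ℕₚ.*-comm _ m) (cong (_* (y zero / m)) (sym (ℕₚ.*-identityʳ m))))) }
      where
      C = toℕ (c zero)
      open ≡-Reasoning
      y%m≡ : y zero % m ≡ C % m
      y%m≡ = begin
        y zero % m              ≡⟨ cong (_% m) (ℕₚ.+-identityʳ (y zero)) ⟨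
        (y zero + 0) % m        ≡⟨ %r%m (y zero + 0) ⟨
        (y zero + 0) % r % m    ≡⟨ cong (_% m) (compat zero) ⟩
        (C + m * z) % r % m     ≡⟨ %r%m (C + m * z) ⟩
        (C + m * z) % m         ≡⟨ cong (λ u → (C + u) % m) (ℕₚ.*-comm m z) ⟩
        (C + z * m) % m         ≡⟨ [m+kn]%n≡m%n C z m ⟩
        C % m                   ∎
    compatible⇒gap {suc (suc n)} c y z compat
      with t , eq ← compatible⇒gap (Vector.tail c) (y ∘ suc) z (compat ∘ suc) = t′ t , λ
        { zero    → y₀≡
        ; (suc i) → eq i
        }
      where
      C₀ = toℕ (c zero)
      C₁ = toℕ (c (suc zero))
      t′ : Vector ℕ (suc n) → Vector ℕ (suc (suc n))
      t′ t zero    = y zero / r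
      t′ t (suc i) = t i
      open ≡-Reasoning
      y₀≡ᵣ : y zero ≡ᵣ gap c zero
      y₀≡ᵣ = +-cancelʳ-≡ᵣ (C₁ + m * z) (begin
        (y zero + (C₁ + m * z)) % r      ≡⟨ +-cong-≡ᵣ {y zero} refl (sym (compat (suc zero))) ⟩
        sum y % r                        ≡⟨ compat zero ⟩
        (C₀ + m * z) % r                 ≡⟨ +-cong-≡ᵣ {C₀} (sym (Residue-minus C₀ C₁)) refl ⟩
        (gap c zero + C₁ + m * z) % r    ≡⟨ cong (_% r) (ℕₚ.+-assoc (gap c zero) C₁ (m * z)) ⟩
        (gap c zero + (C₁ + m * z)) % r  ∎)
      y₀≡ : y zero ≡ gap c zero + m * s * (y zero / r)
      y₀≡ = begin
        y zero                                   ≡⟨ m≡m%n+[m/n]*n (y zero) r ⟩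
        y zero % r + y zero / r * r              ≡⟨ cong₂ _+_ (trans y₀≡ᵣ (m<n⇒m%n≡m gap<r)) (ℕₚ.*-comm _ r) ⟩
        gap c zero + r * (y zero / r)            ≡⟨ cong (λ u → gap c zero + u * (y zero / r)) m*s≡r ⟨
        gap c zero + m * s * (y zero / r)        ∎
        where
        gap<r : gap c zero < r
        gap<r = ℤᵈ.n%ℕd<d (ℤcolour c zero ℤ.- ℤcolour c (suc zero)) r

    -- Change of representative: the k m added to the colours has to leave z, and -k is represented
    -- by (s - 1) k because m s = r.
    compatible-resp : ∀ {n} {c c′ : Vector (Fin r) n} {x z} k → Compatible c x z →
      (∀ i → toℕ (c′ i) ≡ᵣ toℕ (c i) + k * m) → Compatible c′ x (z + ℕ.pred s * k)
    compatible-resp {c = c} {c′} {x} {z} k compat eq i = begin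
      x i % r
        ≡⟨ compat i ⟩
      (toℕ (c i) + m * z) % r
        ≡⟨ +-*r _ k ⟨
      (toℕ (c i) + m * z + k * r) % r
        ≡⟨ cong (_% r) (trans (cong (λ u → toℕ (c i) + m * z + k * u) (trans (sym m*s≡r) (cong (m *_) (sym (ℕₚ.suc-pred s)))))
             (+-*-Solver.solve 5 (λ c m z k p →
               c :+ m :* z :+ k :* (m :* (con 1 :+ p)) := c :+ k :* m :+ m :* (z :+ p :* k))
               refl (toℕ (c i)) m z k (ℕ.pred s))) ⟩
      (toℕ (c i) + k * m + m * (z + ℕ.pred s * k)) % r
        ≡⟨ +-cong-≡ᵣ {toℕ (c i) + k * m} (sym (eq i)) refl ⟩
      (toℕ (c′ i) + m * (z + ℕ.pred s * k)) % r ∎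
      where
      open ≡-Reasoning
      open +-*-Solver using (_:+_; _:*_; _:=_; con)

    -- Supplies the power of the generator that carries c to c′: its exponent stands for z - z′
    -- modulo s.
    compatible-unique : ∀ {n} {c c′ : Vector (Fin r) n} {x z z′} → Compatible c x z → Compatible c′ x z′ →
      ∀ i → toℕ (c′ i) ≡ᵣ toℕ (c i) + (z + ℕ.pred s * z′) * m
    compatible-unique {c = c} {c′} {x} {z} {z′} p p′ i = +-cancelʳ-≡ᵣ (m * z′) (begin
      (toℕ (c′ i) + m * z′) % r
        ≡⟨ trans (sym (p′ i)) (p i) ⟩
      (toℕ (c i) + m * z) % r
        ≡⟨ +-*r _ z′ ⟨
      (toℕ (c i) + m * z + z′ * r) % r
        ≡⟨ cong (_% r) (trans (cong (λ u → toℕ (c i) + m * z + z′ * u) (trans (sym m*s≡r) (cong (m *_) (sym (ℕₚ.suc-pred s)))))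
             (+-*-Solver.solve 5 (λ c m z k p →
               c :+ m :* z :+ k :* (m :* (con 1 :+ p)) := c :+ (z :+ p :* k) :* m :+ m :* k)
               refl (toℕ (c i)) m z z′ (ℕ.pred s))) ⟩
      (toℕ (c i) + (z + ℕ.pred s * z′) * m + m * z′) % r ∎)
      where
      open ≡-Reasoning
      open +-*-Solver using (_:+_; _:*_; _:=_; con)

    module _ {n} (g : ColouredPerm r n) where

      drop : Vector ℕ n
      drop i = indicator (isHDes? g i)

      λᵢ-suffixSums : ∀ i → λᵢ g i ≡ suffixSums (λ j → gap (colour g) j + m * step j * drop j) i
      λᵢ-suffixSums i = begin
        r * h g i + kOf (colour g) i
          ≡⟨ cong₂ (λ u v → r * u + v) (length-filter-≥ (isHDes? g) i) (kOf-gap (colour g) i) ⟩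
        r * suffixSums drop i + suffixSums (gap (colour g)) i
          ≡⟨ ℕₚ.+-comm (r * suffixSums drop i) _ ⟩
        suffixSums (gap (colour g)) i + r * suffixSums drop i
          ≡⟨ cong (suffixSums (gap (colour g)) i +_) (suffixSums-* r drop i) ⟨
        suffixSums (gap (colour g)) i + suffixSums (λ j → r * drop j) i
          ≡⟨ cong (suffixSums (gap (colour g)) i +_) (suffixSums-cong r*drop i) ⟩
        suffixSums (gap (colour g)) i + suffixSums (λ j → m * step j * drop j) i
          ≡⟨ suffixSums-+ (gap (colour g)) _ i ⟨
        suffixSums (λ j → gap (colour g) j + m * step j * drop j) i ∎
        where
        open ≡-Reasoning
        r*drop : ∀ j → r * drop j ≡ m * step j * drop j
        r*drop j with isHDes? g j
        -- A descent has a successor, so its position is not the last one and `m * step j` is r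
        -- there.
        ... | yes (_ , j⋖ , _) = cong (_* 1) (trans (sym m*s≡r) (cong (m *_) (sym (step-⋖ j⋖))))
        ... | no  _            = trans (ℕₚ.*-zeroʳ r) (sym (ℕₚ.*-zeroʳ (m * step j)))

      module _ (b : Vec ℕ n) where

        -- In the notation of the header, letters i is the letter f_{σ(i)} and
        -- content v is f_v.
        differences : Vector ℕ n
        differences i = gap (colour g) i + m * step i * (drop i + Vec.lookup b i)

        letters : Vector ℕ n
        letters = suffixSums differences

        content : Vector ℕ n
        content v = letters (perm g ⟨$⟩ˡ v)

        content-perm : ∀ i → content (perm g ⟨$⟩ʳ i) ≡ letters i
        content-perm i = cong letters (Perm.inverseˡ (perm g))

        letters-λᵢ : ∀ i → letters i ≡ λᵢ g i + suffixSums (λ j → m * step j * Vec.lookup b j) i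
        letters-λᵢ i = begin
          suffixSums differences i
            ≡⟨ suffixSums-cong (λ j → trans (cong (gap (colour g) j +_) (ℕₚ.*-distribˡ-+ (m * step j) (drop j) _))
                                            (sym (ℕₚ.+-assoc (gap (colour g) j) _ _))) i ⟩
          suffixSums (λ j → gap (colour g) j + m * step j * drop j + m * step j * Vec.lookup b j) i
            ≡⟨ suffixSums-+ (λ j → gap (colour g) j + m * step j * drop j) _ i ⟩
          suffixSums (λ j → gap (colour g) j + m * step j * drop j) i + suffixSums (λ j → m * step j * Vec.lookup b j) i
            ≡⟨ cong (_+ suffixSums (λ j → m * step j * Vec.lookup b j) i) (λᵢ-suffixSums i) ⟨
          λᵢ g i + suffixSums (λ j → m * step j * Vec.lookup b j) i ∎
          where open ≡-Reasoning

        letters-compatible : ∃ (Compatible (colour g) letters)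
        letters-compatible = gap⇒compatible (colour g) differences (λ i → drop i + Vec.lookup b i) (λ _ → refl)

        content-sorted : Sorts (perm g) content
        content-sorted {i} {j} i⋖j rewrite content-perm i | content-perm j | suffixSums-⋖ differences i⋖j
          with differences i in diff≡
        ... | suc d = inj₁ (ℕₚ.≤-<-trans (ℕₚ.m≤n+m (letters j) d) ℕₚ.≤-refl)
        ... | zero  = inj₂ (refl , Finₚ.≤∧≢⇒< (ℕₚ.≮⇒≥ (λ πj<πi → noDescent (j , i⋖j , cᵢ≡cⱼ , πj<πi))) πi≢πj)
          where
          open ≡-Reasoning
          gap≡0 : gap (colour g) i ≡ 0
          gap≡0 = ℕₚ.m+n≡0⇒m≡0 _ diff≡
          drop≡0 : drop i ≡ 0
          drop≡0 = ℕₚ.m+n≡0⇒m≡0 (drop i) (ℕₚ.m*n≡0⇒m≡0 (drop i + Vec.lookup b i) (m * step i) {{m*step≢0 i}}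
            (trans (ℕₚ.*-comm _ (m * step i)) (ℕₚ.m+n≡0⇒n≡0 (gap (colour g) i) diff≡)))
          noDescent : ¬ IsHDes g i
          noDescent des-i with isHDes? g i | drop≡0
          ... | no ¬des | _ = ¬des des-i
          Cᵢ = toℕ (colour g i)
          Cⱼ = toℕ (colour g j)
          cᵢ≡cⱼ : colour g i ≡ colour g j
          cᵢ≡cⱼ = Finₚ.toℕ-injective (begin
            Cᵢ                                            ≡⟨ m<n⇒m%n≡m (Finₚ.toℕ<n (colour g i)) ⟨
            Cᵢ % r                                        ≡⟨ Residue-minus Cᵢ Cⱼ ⟨
            (Residue r (ℤ.+ Cᵢ ℤ.- ℤ.+ Cⱼ) + Cⱼ) % r      ≡⟨ cong (λ u → (u + Cⱼ) % r) (trans (sym (gap-⋖ (colour g) i⋖j)) gap≡0) ⟩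
            Cⱼ % r                                        ≡⟨ m<n⇒m%n≡m (Finₚ.toℕ<n (colour g j)) ⟩
            Cⱼ                                            ∎)
          πi≢πj : perm g ⟨$⟩ʳ i ≢ perm g ⟨$⟩ʳ j
          πi≢πj eq = ℕₚ.1+n≢n (trans (sym i⋖j) (cong toℕ (trans (sym (Perm.inverseˡ (perm g)))
            (trans (cong (perm g ⟨$⟩ˡ_) (sym eq)) (Perm.inverseˡ (perm g))))))

        sum-content : sum content ≡ fmaj g + dot (λ i → suc (toℕ i) * (m * step i)) b
        sum-content = begin
          sum content
            ≡⟨ sum-permute letters (Perm.flip (perm g)) ⟨
          sum letters
            ≡⟨ sum-cong-≗ letters-λᵢ ⟩
          sum (λ i → λᵢ g i + suffixSums (λ j → m * step j * Vec.lookup b j) i)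
            ≡⟨ ∑-distrib-+ (λᵢ g) _ ⟩
          fmaj g + sum (suffixSums (λ j → m * step j * Vec.lookup b j))
            ≡⟨ cong (fmaj g +_) (sum-suffixSums {n} (λ j → m * step j * Vec.lookup b j)) ⟩
          fmaj g + sum (λ i → suc (toℕ i) * (m * step i * Vec.lookup b i))
            ≡⟨ cong (fmaj g +_) (sum-cong-≗ {n} (λ i → sym (ℕₚ.*-assoc (suc (toℕ i)) (m * step i) (Vec.lookup b i)))) ⟩
          fmaj g + sum (λ i → suc (toℕ i) * (m * step i) * Vec.lookup b i)
            ≡⟨ cong (fmaj g +_) (dot-sum (λ i → suc (toℕ i) * (m * step i)) b) ⟨
          fmaj g + dot (λ i → suc (toℕ i) * (m * step i)) b ∎
          where open ≡-Reasoning

        -- Letters and colours differ by the shift m z and by multiples of r, all of which vanish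
        -- modulo m.
        sum-content-% : sum (λ v → content v % m) ≡ col g
        sum-content-% = begin
          sum (λ v → content v % m)
            ≡⟨ sum-permute (λ i → letters i % m) (Perm.flip (perm g)) ⟨
          sum (λ i → letters i % m)
            ≡⟨ sum-cong-≗ {n} letters-% ⟩
          col g ∎
          where
          open ≡-Reasoning
          letters-% : ∀ i → letters i % m ≡ toℕ (colour g i) % m
          letters-% i with z , compat ← letters-compatible = begin
            letters i % m                     ≡⟨ %r%m (letters i) ⟨
            letters i % r % m                 ≡⟨ cong (_% m) (compat i) ⟩
            (toℕ (colour g i) + m * z) % r % m  ≡⟨ %r%m _ ⟩
            (toℕ (colour g i) + m * z) % m    ≡⟨ cong (λ u → (toℕ (colour g i) + u) % m) (ℕₚ.*-comm m z) ⟩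
            (toℕ (colour g i) + z * m) % m    ≡⟨ [m+kn]%n≡m%n (toℕ (colour g i)) z m ⟩
            toℕ (colour g i) % m              ∎

        -- Modulo r, hence modulo p, the sum is the colour sum plus n m z. Cancelling s from ps ∣ rn
        -- = n m s gives p ∣ n m.
        ∣-sum-content : ∀ {p} → p ∣ r → p * s ∣ r * n → p ∣ colourSum g → p ∣ sum content
        ∣-sum-content {p} p∣r ps∣rn p∣cs with z , compat ← letters-compatible =
          subst (p ∣_) (sum-permute letters (Perm.flip (perm g)))
            (∣-resp-≡ᵣ p∣r (sym (sum-cong-≡ᵣ compat)) (subst (p ∣_) (sym (sum-shifted z)) (∣m∣n⇒∣m+n p∣cs (∣m⇒∣m*n z p∣nm))))
          where
          open ≡-Reasoning
          p∣nm : p ∣ n * m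
          p∣nm = *-cancelʳ-∣ s (subst (p * s ∣_) (begin
            r * n        ≡⟨ ℕₚ.*-comm r n ⟩
            n * r        ≡⟨ cong (n *_) m*s≡r ⟨
            n * (m * s)  ≡⟨ ℕₚ.*-assoc n m s ⟨
            n * m * s    ∎) ps∣rn)
          sum-const : ∀ n k → sum {n} (λ _ → k) ≡ n * k
          sum-const zero    k = refl
          sum-const (suc n) k = cong (k +_) (sum-const n k)
          sum-shifted : ∀ z → sum (λ i → toℕ (colour g i) + m * z) ≡ colourSum g + n * m * z
          sum-shifted z = begin
            sum (λ i → toℕ (colour g i) + m * z)  ≡⟨ ∑-distrib-+ (λ i → toℕ (colour g i)) (λ _ → m * z) ⟩
            colourSum g + sum {n} (λ _ → m * z)   ≡⟨ cong (colourSum g +_) (sum-const n (m * z)) ⟩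
            colourSum g + n * (m * z)             ≡⟨ cong (colourSum g +_) (ℕₚ.*-assoc n m z) ⟨
            colourSum g + n * m * z               ∎

    content-injective : ∀ {n} (g : ColouredPerm r n) (b b′ : Vec ℕ n) → content g b ≗ content g b′ → b ≡ b′
    content-injective g b b′ eq = begin
      b                                  ≡⟨ Vecₚ.tabulate∘lookup b ⟨
      Vec.tabulate (Vec.lookup b)        ≡⟨ Vecₚ.tabulate-cong lookup≡ ⟩
      Vec.tabulate (Vec.lookup b′)       ≡⟨ Vecₚ.tabulate∘lookup b′ ⟩
      b′                                 ∎
      where
      open ≡-Reasoning
      differences≡ : differences g b ≗ differences g b′
      differences≡ = suffixSums-injective λ i →
        trans (sym (content-perm g b i)) (trans (eq _) (content-perm g b′ i))
      lookup≡ : Vec.lookup b ≗ Vec.lookup b′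
      lookup≡ i = ℕₚ.+-cancelˡ-≡ (drop g i) _ _ (ℕₚ.*-cancelˡ-≡ _ _ (m * step i) {{m*step≢0 i}}
        (ℕₚ.+-cancelˡ-≡ (gap (colour g) i) _ _ (differences≡ i)))

    content-determines-perm : ∀ {n} (g g′ : ColouredPerm r n) (b b′ : Vec ℕ n) →
      content g b ≗ content g′ b′ → perm g Perm.≈ perm g′
    content-determines-perm g g′ b b′ eq = sort-unique {f = content g b} (perm g) (perm g′) (content-sorted g b) resorted
      where
      resorted : Sorts (perm g′) (content g b)
      resorted {i} {j} i⋖j with content-sorted g′ b′ i⋖j
      ... | inj₁ p       = inj₁ (subst₂ _<_ (sym (eq _)) (sym (eq _)) p)
      ... | inj₂ (e , p) = inj₂ (trans (eq _) (trans e (sym (eq _))) , p)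

    letters-compatible-with : ∀ {n} (g g′ : ColouredPerm r n) (b b′ : Vec ℕ n) →
      content g b ≗ content g′ b′ → ∃ (Compatible (colour g′) (letters g b))
    letters-compatible-with g g′ b b′ eq with z , compat ← letters-compatible g′ b′ =
      z , λ i → trans (cong (_% r) (letters≡ i)) (compat i)
      where
      letters≡ : letters g b ≗ letters g′ b′
      letters≡ i = trans (sym (content-perm g b i)) (trans (eq _)
        (trans (cong (content g′ b′) (content-determines-perm g g′ b b′ eq i)) (content-perm g′ b′ i)))

    -- The letters in sorted order are weakly decreasing, hence suffix sums of differences y;
    -- division of these yields t, and b is what t leaves after the obligatory drops.
    content-surjective : ∀ {n} (g : ColouredPerm r n) (f : Vector ℕ n) z → Sorts (perm g) f →
      Compatible (colour g) (λ i → f (perm g ⟨$⟩ʳ i)) z → ∃ λ b → content g b ≗ f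
    content-surjective {n} g f z sorts compat
      with y , y≡ ← suffixSums-surjective (λ i → f (perm g ⟨$⟩ʳ i)) (λ i⋖j → ≺⇒≥ {f = f} (sorts i⋖j))
      with t , t≡ ← compatible⇒gap (colour g) y z (λ i → trans (cong (_% r) (y≡ i)) (compat i)) =
      b , λ v → begin
        letters g b (perm g ⟨$⟩ˡ v)          ≡⟨ suffixSums-cong differences≡y (perm g ⟨$⟩ˡ v) ⟩
        suffixSums y (perm g ⟨$⟩ˡ v)         ≡⟨ y≡ (perm g ⟨$⟩ˡ v) ⟩
        f (perm g ⟨$⟩ʳ (perm g ⟨$⟩ˡ v))      ≡⟨ cong f (Perm.inverseʳ (perm g)) ⟩
        f v                                  ∎
      where
      open ≡-Reasoning
      -- At a homogeneous descent the gap is zero, so t = 0 would make neighbouring letters equal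
      -- with decreasing positions, against the rule for ties.
      drop≤t : ∀ i → drop g i ≤ t i
      drop≤t i with isHDes? g i
      ... | no _ = z≤n
      ... | yes (j , i⋖j , c≡ , πj<πi) with t i | t≡ i
      ...   | suc _ | _    = s≤s z≤n
      ...   | zero  | yᵢ≡ = contradiction (sorts i⋖j) λ where
          (inj₁ lt)          → ℕₚ.<-irrefl (sym fᵢ≡fⱼ) lt
          (inj₂ (_ , πi<πj)) → ℕₚ.<-asym πi<πj πj<πi
        where
        gap≡0 : gap (colour g) i ≡ 0
        gap≡0 = begin
          gap (colour g) i
            ≡⟨ gap-⋖ (colour g) i⋖j ⟩
          Residue r (ℤcolour (colour g) i ℤ.- ℤcolour (colour g) j)
            ≡⟨ cong (λ c → Residue r (ℤ.+ toℕ c ℤ.- ℤcolour (colour g) j)) c≡ ⟩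
          Residue r (ℤcolour (colour g) j ℤ.- ℤcolour (colour g) j)
            ≡⟨ cong (Residue r) (ℤₚ.+-inverseʳ (ℤcolour (colour g) j)) ⟩
          0 % r
            ≡⟨ m*n%n≡0 0 r ⟩
          0 ∎
        fᵢ≡fⱼ : f (perm g ⟨$⟩ʳ i) ≡ f (perm g ⟨$⟩ʳ j)
        fᵢ≡fⱼ = begin
          f (perm g ⟨$⟩ʳ i)                       ≡⟨ y≡ i ⟨
          suffixSums y i                          ≡⟨ suffixSums-⋖ y i⋖j ⟩
          y i + suffixSums y j                    ≡⟨ cong (_+ suffixSums y j) (trans yᵢ≡ (cong₂ _+_ gap≡0 (ℕₚ.*-zeroʳ (m * step i)))) ⟩
          suffixSums y j                          ≡⟨ y≡ j ⟩
          f (perm g ⟨$⟩ʳ j)                       ∎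

      b = Vec.tabulate (λ i → t i ∸ drop g i)

      differences≡y : differences g b ≗ y
      differences≡y i = begin
        gap (colour g) i + m * step i * (drop g i + Vec.lookup b i)
          ≡⟨ cong (λ u → gap (colour g) i + m * step i * (drop g i + u)) (Vecₚ.lookup∘tabulate _ i) ⟩
        gap (colour g) i + m * step i * (drop g i + (t i ∸ drop g i))
          ≡⟨ cong (λ u → gap (colour g) i + m * step i * u) (ℕₚ.m+[n∸m]≡n (drop≤t i)) ⟩
        gap (colour g) i + m * step i * t i
          ≡⟨ t≡ i ⟨
        y i ∎

    -- The largest letter and the descent number

    module _ {n} .{{_ : NonZero n}} (g : ColouredPerm r n) where

      s≤sλ+r : s ≤ s * λᵢ g first + r
      s≤sλ+r = ℕₚ.≤-trans (∣⇒≤ s∣r) (ℕₚ.m≤n+m r _)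

      -- With r = m s, `des g` is λ₁ / m rounded up, so it is at most k exactly if λ₁ ≤ k m; `des≤⁻`
      -- is the other half.
      des≤⁺ : ∀ k → λᵢ g first ≤ k * m → des g ≤ k
      des≤⁺ k λ≤ = ℕₚ.≤-pred (m<n*o⇒m/o<n {o = r} (ℕₚ.+-cancelʳ-< s _ _ (begin-strict
        s * λᵢ g first + r ∸ s + s  ≡⟨ ℕₚ.m∸n+n≡m s≤sλ+r ⟩
        s * λᵢ g first + r          ≤⟨ ℕₚ.+-monoˡ-≤ r (ℕₚ.*-monoʳ-≤ s λ≤) ⟩
        s * (k * m) + r             ≡⟨ cong (_+ r) (trans (ℕₚ.*-comm s (k * m)) (trans (ℕₚ.*-assoc k m s) (cong (k *_) m*s≡r))) ⟩
        k * r + r                   ≡⟨ ℕₚ.+-comm (k * r) r ⟩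
        suc k * r                   <⟨ ℕₚ.m<m+n (suc k * r) (ℕ.>-nonZero⁻¹ s) ⟩
        suc k * r + s               ∎)))
        where open ℕₚ.≤-Reasoning

      des≤⁻ : ∀ k → des g ≤ k → λᵢ g first ≤ k * m
      des≤⁻ k des≤ = ℕₚ.≤-pred (ℕₚ.*-cancelˡ-< s _ _ (ℕₚ.+-cancelʳ-< r _ _ (begin-strict
        s * λᵢ g first + r          ≡⟨ ℕₚ.m∸n+n≡m s≤sλ+r ⟨
        N + s                       ≡⟨ cong (_+ s) (m≡m%n+[m/n]*n N r) ⟩
        N % r + N / r * r + s       <⟨ ℕₚ.+-monoˡ-< s (ℕₚ.+-mono-<-≤ (m%n<n N r) (ℕₚ.*-monoˡ-≤ r des≤)) ⟩
        r + k * r + s               ≡⟨ cong (λ u → r + k * u + s) m*s≡r ⟨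
        r + k * (m * s) + s         ≡⟨ +-*-Solver.solve 4 (λ r k m s →
                                         r :+ k :* (m :* s) :+ s := s :* (con 1 :+ k :* m) :+ r) refl r k m s ⟩
        s * suc (k * m) + r         ∎)))
        where
        N = s * λᵢ g first + r ∸ s
        open ℕₚ.≤-Reasoning
        open +-*-Solver using (_:+_; _:*_; _:=_; con)

    module _ {n} (g : ColouredPerm r (suc n)) (b : Vec ℕ (suc n)) where

      letters-zero : letters g b zero ≡ λᵢ g zero + m * dot step b
      letters-zero = begin
        letters g b zero
          ≡⟨ letters-λᵢ g b zero ⟩
        λᵢ g zero + sum (λ j → m * step j * Vec.lookup b j)
          ≡⟨ cong (λᵢ g zero +_) (sum-cong-≗ {suc n} (λ j → ℕₚ.*-assoc m (step j) (Vec.lookup b j))) ⟩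
        λᵢ g zero + sum (λ j → m * (step j * Vec.lookup b j))
          ≡⟨ cong (λᵢ g zero +_) (*-distribˡ-sum {suc n} m (λ j → step j * Vec.lookup b j)) ⟨
        λᵢ g zero + m * sum (λ j → step j * Vec.lookup b j)
          ≡⟨ cong (λ u → λᵢ g zero + m * u) (dot-sum step b) ⟨
        λᵢ g zero + m * dot step b ∎
        where open ≡-Reasoning

      -- The first letter is the largest and equals λ₁ + m D with D = dot step b, so the bound on
      -- the whole word becomes des g ≤ k - D.
      content-bounded⁺ : ∀ k → des g + dot step b ≤ k → ∀ v → content g b v ≤ k * m
      content-bounded⁺ k des+D≤k v = begin
        content g b v                 ≤⟨ suffixSums≤sum (differences g b) (perm g ⟨$⟩ˡ v) ⟩
        letters g b zero              ≡⟨ letters-zero ⟩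
        λᵢ g zero + m * D             ≤⟨ ℕₚ.+-monoˡ-≤ (m * D) (des≤⁻ g (k ∸ D) (ℕₚ.m+n≤o⇒m≤o∸n (des g) des+D≤k)) ⟩
        (k ∸ D) * m + m * D           ≡⟨ cong ((k ∸ D) * m +_) (ℕₚ.*-comm m D) ⟩
        (k ∸ D) * m + D * m           ≡⟨ ℕₚ.*-distribʳ-+ m (k ∸ D) D ⟨
        (k ∸ D + D) * m               ≡⟨ cong (_* m) (ℕₚ.m∸n+n≡m (ℕₚ.m+n≤o⇒n≤o (des g) des+D≤k)) ⟩
        k * m                         ∎
        where
        open ℕₚ.≤-Reasoning
        D = dot step b

      content-bounded⁻ : ∀ k → (∀ v → content g b v ≤ k * m) → des g + dot step b ≤ k
      content-bounded⁻ k bounded = begin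
        des g + D         ≤⟨ ℕₚ.+-monoˡ-≤ D (des≤⁺ g (k ∸ D) λ≤) ⟩
        k ∸ D + D         ≡⟨ ℕₚ.m∸n+n≡m D≤k ⟩
        k                 ∎
        where
        open ℕₚ.≤-Reasoning
        D = dot step b
        first≤ : λᵢ g zero + m * D ≤ k * m
        first≤ = begin
          λᵢ g zero + m * D               ≡⟨ letters-zero ⟨
          letters g b zero                ≡⟨ content-perm g b zero ⟨
          content g b (perm g ⟨$⟩ʳ zero)  ≤⟨ bounded _ ⟩
          k * m                           ∎
        -- Ensures that the truncated subtraction `k ∸ D` is exact.
        D≤k : D ≤ k
        D≤k = ℕₚ.*-cancelˡ-≤ m (ℕₚ.≤-trans (ℕₚ.m+n≤o⇒n≤o (λᵢ g zero) first≤) (ℕₚ.≤-reflexive (ℕₚ.*-comm k m)))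
        λ≤ : λᵢ g zero ≤ (k ∸ D) * m
        λ≤ = begin
          λᵢ g zero                ≤⟨ ℕₚ.m+n≤o⇒m≤o∸n (λᵢ g zero) first≤ ⟩
          k * m ∸ m * D            ≡⟨ cong (k * m ∸_) (ℕₚ.*-comm m D) ⟩
          k * m ∸ D * m            ≡⟨ ℕₚ.*-distribʳ-∸ m k D ⟨
          (k ∸ D) * m              ∎

  -- Injectivity is asked on members only: `word` forgets the slack entry b₀, which can be recovered
  -- just for vectors known to lie in `exponents k x`.
  map-unique : ∀ {a b} {A : Set a} {B : Set b} (f : A → B) {xs} →
    (∀ {x y} → x ∈ xs → y ∈ xs → f x ≡ f y → x ≡ y) → Unique xs → Unique (map f xs)
  map-unique f {[]}     inj []       = []
  map-unique f {x ∷ xs} inj (x∉ ∷ u) =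
    Allₚ.map⁺ (All.tabulate (λ y∈ fx≡fy → All.lookup x∉ y∈ (inj (here refl) (there y∈) fx≡fy))) ∷
    map-unique f (λ x∈ y∈ → inj (there x∈) (there y∈)) u

  -- Words against cosets with exponents

  module Bijection (r p s n′ : ℕ) .{{_ : NonZero r}} .{{_ : NonZero p}} .{{_ : NonZero s}}
    (p∣r : p ∣ r) (s∣r : s ∣ r) (ps∣rn : p * s ∣ r * suc n′) where
    private
      n = suc n′
    open Statistics r s s∣r
    open Encoding r s s∣r
    open Congruence r
    open Quotient r p s n s∣r

    ⊛-∙-colour : ∀ k (g : ColouredPerm r n) i →
      toℕ (colour ((k ⊛ generator) ∙ g) i) ≡ (toℕ (colour g i) + k * m) % r
    ⊛-∙-colour k g i = begin
      toℕ (colour g i ⊕ colour (k ⊛ generator) (perm g ⟨$⟩ʳ i))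
        ≡⟨ toℕ-mod _ ⟩
      (toℕ (colour g i) + toℕ (colour (k ⊛ generator) (perm g ⟨$⟩ʳ i))) % r
        ≡⟨ cong (λ c → (toℕ (colour g i) + toℕ c) % r) (power-colour k (perm g ⟨$⟩ʳ i)) ⟩
      (toℕ (colour g i) + toℕ ((k * m) mod r)) % r
        ≡⟨ cong (λ c → (toℕ (colour g i) + c) % r) (toℕ-mod (k * m)) ⟩
      (toℕ (colour g i) + (k * m) % r) % r
        ≡⟨ +-cong-≡ᵣ {toℕ (colour g i)} refl (m%n%n≡m%n (k * m) r) ⟩
      (toℕ (colour g i) + k * m) % r ∎
      where open ≡-Reasoning

    -- Equal words are sorted by the same permutation, so both colourings are compatible with the
    -- same letters and differ by a power of the generator.
    content-determines-coset : ∀ (x y : SubG r p n) (b b′ : Vec ℕ n) →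
      content (proj₁ x) b ≗ content (proj₁ y) b′ → x ∼ y
    content-determines-coset (g , _) (g′ , _) b b′ eq
      with z , compat ← letters-compatible g b
      with z′ , compat′ ← letters-compatible-with g g′ b b′ eq = k ,
        ((λ i → Finₚ.toℕ-injective (trans (sym (m<n⇒m%n≡m (Finₚ.toℕ<n (colour g′ i))))
           (trans (compatible-unique {c = colour g} {colour g′} compat compat′ i) (sym (⊛-∙-colour k g i)))))
        , (λ i → trans (sym (content-determines-perm g g′ b b′ eq i)) (sym (power-perm k (perm g ⟨$⟩ʳ i)))))
      where k = z + ℕ.pred s * z′

    -- The exponents of t and q in the factors of the denominator; the first
    -- factor is 1 - t.
    tDegree qDegree : Vector ℕ (suc n)
    tDegree zero    = 1
    tDegree (suc i) = step i
    qDegree zero    = 0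
    qDegree (suc i) = suc (toℕ i) * (m * step i)

    tDegree>0 : ∀ i → 0 < tDegree i
    tDegree>0 zero    = s≤s z≤n
    tDegree>0 (suc i) = step>0 i

    word : SubG r p n → Vec ℕ (suc n) → Vec ℕ n
    word x (_ ∷ b) = Vec.tabulate (content (proj₁ x) b)

    -- The shift stands for the factor t^des: the members `b₀ ∷ b` are the solutions of des + b₀ +
    -- dot step b = k.
    exponents : ℕ → SubG r p n → List (Vec ℕ (suc n))
    exponents k x = shift [] (des (proj₁ x)) (solutions tDegree) k

    exponents-unique : ∀ k x → Unique (exponents k x)
    exponents-unique k x = shift-unique (des (proj₁ x)) (solutions tDegree) (solutions-unique tDegree) k

    ∈-exponents⁻ : ∀ k x b₀ b → (b₀ ∷ b) ∈ exponents k x → k ≡ des (proj₁ x) + (b₀ + dot step b)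
    ∈-exponents⁻ k x b₀ b b∈ with j , k≡ , b∈ ← ∈-shift⁻ (des (proj₁ x)) (solutions tDegree) k b∈ =
      trans k≡ (cong (des (proj₁ x) +_) (trans (sym (∈-solutions⁻ tDegree j b∈))
        (cong (_+ dot step b) (ℕₚ.*-identityˡ b₀))))

    ∈-exponents⁺ : ∀ k x b → des (proj₁ x) + dot step b ≤ k → ∃ λ b₀ → (b₀ ∷ b) ∈ exponents k x
    ∈-exponents⁺ k x b ≤k = b₀ , subst ((b₀ ∷ b) ∈_) (cong (λ k → exponents k x) k≡)
      (∈-shift⁺ (des (proj₁ x)) (solutions tDegree) (∈-solutions⁺ tDegree tDegree>0 (dot tDegree (b₀ ∷ b)) refl))
      where
      open ≡-Reasoning
      D = dot step b
      b₀ = k ∸ (des (proj₁ x) + D)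
      k≡ : des (proj₁ x) + (1 * b₀ + D) ≡ k
      k≡ = begin
        des (proj₁ x) + (1 * b₀ + D)  ≡⟨ cong (λ u → des (proj₁ x) + (u + D)) (ℕₚ.*-identityˡ b₀) ⟩
        des (proj₁ x) + (b₀ + D)      ≡⟨ cong (des (proj₁ x) +_) (ℕₚ.+-comm b₀ D) ⟩
        des (proj₁ x) + (D + b₀)      ≡⟨ ℕₚ.+-assoc (des (proj₁ x)) D b₀ ⟨
        des (proj₁ x) + D + b₀        ≡⟨ ℕₚ.m+[n∸m]≡n ≤k ⟩
        k                             ∎

    words : List (SubG r p n) → ℕ → List (Vec ℕ n)
    words reps k = concatMap (λ x → map (word x) (exponents k x)) reps

    tabulate-injective : ∀ {f g : Vector ℕ n} → Vec.tabulate f ≡ Vec.tabulate g → f ≗ g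
    tabulate-injective {f} {g} eq i = trans (sym (Vecₚ.lookup∘tabulate f i))
      (trans (cong (λ v → Vec.lookup v i) eq) (Vecₚ.lookup∘tabulate g i))

    -- Within one coset the word gives back b, and then k gives back b₀; words from different cosets
    -- are kept apart by `content-determines-coset`.
    words-unique : ∀ {reps} → AllPairs (λ x y → ¬ (x ∼ y)) reps → ∀ k → Unique (words reps k)
    words-unique {reps} distinct k = Uniqueₚ.concat⁺
      (Allₚ.map⁺ (All.universal (λ x → map-unique (word x) (word-injective x) (exponents-unique k x)) reps))
      (AllPairsₚ.map⁺ (AllPairs.map (λ {x} {y} → disjoint x y) distinct))
      where
      word-injective : ∀ x {b b′} → b ∈ exponents k x → b′ ∈ exponents k x → word x b ≡ word x b′ → b ≡ b′
      word-injective x {b₀ ∷ b} {b₀′ ∷ b′} b∈ b∈′ eq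
        with refl ← content-injective (proj₁ x) b b′ (tabulate-injective eq) =
        cong (_∷ b) (ℕₚ.+-cancelʳ-≡ (dot step b) b₀ b₀′ (ℕₚ.+-cancelˡ-≡ (des (proj₁ x)) _ _
          (trans (sym (∈-exponents⁻ k x b₀ b b∈)) (∈-exponents⁻ k x b₀′ b b∈′))))
      coset : ∀ x y {v} → (∃ λ b → b ∈ exponents k x × v ≡ word x b) →
        (∃ λ b → b ∈ exponents k y × v ≡ word y b) → x ∼ y
      coset x y (_ ∷ b , _ , eq) (_ ∷ b′ , _ , eq′) =
        content-determines-coset x y b b′ (tabulate-injective (trans (sym eq) eq′))
      disjoint : ∀ x y → ¬ (x ∼ y) → Disjoint (map (word x) (exponents k x)) (map (word y) (exponents k y))
      disjoint x y x≁y (v∈ , v∈′) = x≁y (coset x y (∈-map⁻ (word x) v∈) (∈-map⁻ (word y) v∈′))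

    divisibleWords : ℕ → List (Vec ℕ n)
    divisibleWords k = filter (λ v → p ∣? Vec.sum v) (tuples (downFrom (suc (k * m))) n)

    words⊆divisibleWords : ∀ reps k {v} → v ∈ words reps k → v ∈ divisibleWords k
    words⊆divisibleWords reps k v∈
      with x , _ , v∈ ← find (∈-concatMap⁻ (λ x → map (word x) (exponents k x)) {xs = reps} v∈)
      with b₀ ∷ b , b∈ , refl ← ∈-map⁻ (word x) v∈ =
      ∈-filter⁺ (λ v → p ∣? Vec.sum v)
        (∈-tuples⁺ _ (word x (b₀ ∷ b)) λ i → ∈-downFrom⁺ (s≤s
          (subst (_≤ k * m) (sym (Vecₚ.lookup∘tabulate (content (proj₁ x) b) i))
            (content-bounded⁺ (proj₁ x) b k des+D≤k i))))
        (subst (p ∣_) (sym (sum-tabulate (content (proj₁ x) b)))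
          (∣-sum-content (proj₁ x) b p∣r ps∣rn (proj₂ x)))
      where
      des+D≤k : des (proj₁ x) + dot step b ≤ k
      des+D≤k = ℕₚ.≤-trans (ℕₚ.+-monoʳ-≤ (des (proj₁ x)) (ℕₚ.m≤n+m (dot step b) b₀))
        (ℕₚ.≤-reflexive (sym (∈-exponents⁻ k x b₀ b b∈)))

    module _ (v : Vec ℕ n) (p∣v : p ∣ Vec.sum v) (π : Permutation′ n) (sorts-v : Sorts π (Vec.lookup v)) where
      private
        f = Vec.lookup v

      sortedColouring : ColouredPerm r n
      sortedColouring = (λ i → f (π ⟨$⟩ʳ i) mod r) ⨾ π

      p∣colourSum : p ∣ colourSum sortedColouring
      p∣colourSum = ∣-resp-≡ᵣ p∣r
        (sum-cong-≡ᵣ {x = λ i → f (π ⟨$⟩ʳ i)} (λ i → sym (trans (cong (_% r) (toℕ-mod (f (π ⟨$⟩ʳ i)))) (m%n%n≡m%n (f (π ⟨$⟩ʳ i)) r))))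
        (subst (p ∣_) sum≡ p∣v)
        where
        sum≡ : Vec.sum v ≡ sum (λ i → f (π ⟨$⟩ʳ i))
        sum≡ = trans (cong Vec.sum (sym (Vecₚ.tabulate∘lookup v))) (trans (sum-tabulate f) (sum-permute f π))

      -- `sortedColouring` itself, compatible with z = 0, may not be the listed representative of
      -- its coset, so the word is recovered from an arbitrary member x.
      encode : ∀ x → (sortedColouring , p∣colourSum) ∼ x → ∃ λ b → content (proj₁ x) b ≗ f
      encode (g , _) (k , (c≡ , π≈)) = content-surjective g f _ sorts
        (compatible-resp {c = colour sortedColouring} {colour g} k compatible (λ i →
          trans (cong (_% r) (trans (cong toℕ (c≡ i)) (⊛-∙-colour k sortedColouring i))) (m%n%n≡m%n _ r)))
        where
        perm≡ : ∀ i → perm g ⟨$⟩ʳ i ≡ π ⟨$⟩ʳ i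
        perm≡ i = trans (π≈ i) (power-perm k (π ⟨$⟩ʳ i))
        sorts : Sorts (perm g) f
        sorts {i} {j} i⋖j = subst₂ (f ⊢_≺_) (sym (perm≡ i)) (sym (perm≡ j)) (sorts-v i⋖j)
        compatible : Compatible (colour sortedColouring) (λ i → f (perm g ⟨$⟩ʳ i)) 0
        compatible i = begin
          f (perm g ⟨$⟩ʳ i) % r                          ≡⟨ cong (λ j → f j % r) (perm≡ i) ⟩
          f (π ⟨$⟩ʳ i) % r                               ≡⟨ m%n%n≡m%n _ r ⟨
          f (π ⟨$⟩ʳ i) % r % r                           ≡⟨ cong (_% r) (toℕ-mod (f (π ⟨$⟩ʳ i))) ⟨
          toℕ (f (π ⟨$⟩ʳ i) mod r) % r                   ≡⟨ cong (_% r) (trans (cong (toℕ (f (π ⟨$⟩ʳ i) mod r) +_) (ℕₚ.*-zeroʳ m)) (ℕₚ.+-identityʳ _)) ⟨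
          (toℕ (f (π ⟨$⟩ʳ i) mod r) + m * 0) % r         ∎
          where open ≡-Reasoning

    ∈-exponents-words : ∀ k (v : Vec ℕ n) x → (∀ i → Vec.lookup v i ≤ k * m) →
      (∃ λ b → content (proj₁ x) b ≗ Vec.lookup v) → v ∈ map (word x) (exponents k x)
    ∈-exponents-words k v x bounded (b , eq) = subst (_∈ map (word x) (exponents k x))
      (trans (Vecₚ.tabulate-cong eq) (Vecₚ.tabulate∘lookup v))
      (∈-map⁺ (word x) (proj₂ (∈-exponents⁺ k x b
        (content-bounded⁻ (proj₁ x) b k (λ i → subst (_≤ k * m) (sym (eq i)) (bounded i))))))

    divisibleWords⊆words : ∀ {reps} → (∀ x → Any (x ∼_) reps) →
      ∀ k {v} → v ∈ divisibleWords k → v ∈ words reps k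
    divisibleWords⊆words {reps} complete k {v} v∈ = fromSort (sort (Vec.lookup v))
      where
      in-tuples : v ∈ tuples (downFrom (suc (k * m))) n × p ∣ Vec.sum v
      in-tuples = ∈-filter⁻ (λ v → p ∣? Vec.sum v) v∈
      bounded : ∀ i → Vec.lookup v i ≤ k * m
      bounded i = ℕₚ.≤-pred (∈-downFrom⁻ (∈-tuples⁻ (downFrom (suc (k * m))) v (proj₁ in-tuples) i))
      p∣v = proj₂ in-tuples
      fromSort : (∃ λ π → Sorts π (Vec.lookup v)) → v ∈ words reps k
      fromSort (π , sorts) = ∈-concatMap⁺ (λ x → map (word x) (exponents k x)) {xs = reps}
        (Any.map (λ {x} x∼ → ∈-exponents-words k v x bounded (encode v p∣v π sorts x x∼))
                 (complete (sortedColouring v p∣v π sorts , p∣colourSum v p∣v π sorts)))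

    divisibleWords↭words : ∀ {reps} → (∀ x → Any (x ∼_) reps) → AllPairs (λ x y → ¬ (x ∼ y)) reps →
      ∀ k → divisibleWords k ↭ words reps k
    divisibleWords↭words {reps} complete distinct k = unique∧set⇒↭
      (Uniqueₚ.filter⁺ (λ v → p ∣? Vec.sum v) (tuples-unique (Uniqueₚ.downFrom⁺ (suc (k * m))) n))
      (words-unique {reps} distinct k) (divisibleWords⊆words {reps} complete k) (words⊆divisibleWords reps k)

    sum-word : ∀ x b → Vec.sum (word x b) ≡ fmaj (proj₁ x) + dot qDegree b
    sum-word x (_ ∷ b) = trans (sum-tabulate (content (proj₁ x) b)) (sum-content (proj₁ x) b)

    sum-word-% : ∀ x b → Vec.sum (Vec.map (_% m) (word x b)) ≡ col (proj₁ x)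
    sum-word-% x (_ ∷ b) = begin
      Vec.sum (Vec.map (_% m) (Vec.tabulate (content (proj₁ x) b)))
        ≡⟨ cong Vec.sum (Vecₚ.tabulate-∘ (_% m) (content (proj₁ x) b)) ⟨
      Vec.sum (Vec.tabulate (λ v → content (proj₁ x) b v % m))
        ≡⟨ sum-tabulate (λ v → content (proj₁ x) b v % m) ⟩
      sum (λ v → content (proj₁ x) b v % m)
        ≡⟨ sum-content-% (proj₁ x) b ⟩
      col (proj₁ x) ∎
      where open ≡-Reasoning

open Combinatorics

-- The denominator as a single product

module DenominatorFactors {c ℓ} (R : CommutativeRing c ℓ) (t q : CommutativeRing.Carrier R) where
  open CommutativeRing R hiding (zero; _-_)
  open RingOps rawRing using (_^_; _-_; product)
  open import Algebra.Properties.Monoid.Sum *-monoid using (sum-init-last; sum-cong-≗)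
  open SetoidReasoning setoid

  module _ (r p s n′ : ℕ) .{{_ : NonZero r}} .{{_ : NonZero p}} .{{_ : NonZero s}}
    (p∣r : p ∣ r) (s∣r : s ∣ r) (ps∣rn : p ℕ.* s ∣ r ℕ.* suc n′) where
    open Bijection r p s n′ p∣r s∣r ps∣rn using (tDegree; qDegree)
    open Encoding r s s∣r using (step; m; m*s≡r)

    step-inject₁ : ∀ {n} (i : Fin n) → step (Fin.inject₁ i) ≡ s
    step-inject₁ {suc n} zero    = ≡.refl
    step-inject₁ {suc n} (suc i) = step-inject₁ i

    step-fromℕ : ∀ n → step (Fin.fromℕ n) ≡ 1
    step-fromℕ zero    = ≡.refl
    step-fromℕ (suc n) = step-fromℕ n

    -- `product` is the sum of the multiplicative monoid, so `sum-init-last` detaches the final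
    -- factor, the only one with `step` equal to 1 instead of s.
    denominator-factors :
      (1# - t) * product {n′} (λ i → 1# - t ^ s * q ^ (suc (toℕ i) ℕ.* r)) * (1# - t * q ^ (suc n′ ℕ.* r / s)) ≈
      product (λ i → 1# - t ^ tDegree i * q ^ qDegree i)
    denominator-factors = begin
      (1# - t) * product {n′} (λ i → 1# - t ^ s * q ^ (suc (toℕ i) ℕ.* r)) * (1# - t * q ^ (suc n′ ℕ.* r / s))
        ≈⟨ *-assoc _ _ _ ⟩
      (1# - t) * (product {n′} (λ i → 1# - t ^ s * q ^ (suc (toℕ i) ℕ.* r)) * (1# - t * q ^ (suc n′ ℕ.* r / s)))
        ≈⟨ *-cong (+-congˡ (-‿cong (sym (trans (*-identityʳ _) (*-identityʳ t)))))
             (*-cong (reflexive (sum-cong-≗ {n′} inner)) (+-congˡ (-‿cong outer))) ⟩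
      factor zero * (product {n′} (λ i → factor (suc (Fin.inject₁ i))) * factor (suc (Fin.fromℕ n′)))
        ≈⟨ *-congˡ (sum-init-last {n′} (factor ∘ suc)) ⟨
      product factor ∎
      where
      factor : Vector Carrier (suc (suc n′))
      factor i = 1# - t ^ tDegree i * q ^ qDegree i
      inner : ∀ i → 1# - t ^ s * q ^ (suc (toℕ i) ℕ.* r) ≡ factor (suc (Fin.inject₁ i))
      inner i rewrite step-inject₁ i | Finₚ.toℕ-inject₁ i | m*s≡r = ≡.refl
      -- The exponent on the left is parsed as (n r) / s; it becomes n m because s divides r.
      outer : t * q ^ (suc n′ ℕ.* r / s) ≈ t ^ step (Fin.fromℕ n′) * q ^ (suc (toℕ (Fin.fromℕ n′)) ℕ.* (m ℕ.* step (Fin.fromℕ n′)))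
      outer rewrite step-fromℕ n′ | Finₚ.toℕ-fromℕ n′ | ℕₚ.*-identityʳ m | *-/-assoc (suc n′) s∣r =
        *-congʳ (sym (*-identityʳ t))

-- Comparison of the two sides over an arbitrary coefficient ring

module BothSides {c ℓ} (R : CommutativeRing c ℓ) (y : CommutativeRing.Carrier R)
  (r p s n′ : ℕ) .{{_ : NonZero r}} .{{_ : NonZero p}} .{{_ : NonZero s}}
  (p∣r : p ∣ r) (s∣r : s ∣ r) (ps∣rn : p ℕ.* s ∣ r ℕ.* suc n′) where
  private
    n = suc n′
    S = SeriesRing.seriesRing R
    module R = CommutativeRing R
    module S = CommutativeRing S
    module T = CommutativeRing (SeriesRing.seriesRing S)
  open RingOps S.rawRing using ([_]_) renaming (_^_ to _^ₛ_)
  open PowerSeries S.rawRing using (var; const) renaming (_÷_ to _÷ₜ_)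
  open ListSums S
  open Quotient r p s n s∣r using (_∼_)
  open Statistics r s s∣r using (des; fmaj; col)
  open Encoding r s s∣r using (m; m≢0)
  open Bijection r p s n′ p∣r s∣r ps∣rn

  q a : S.Carrier
  q = PowerSeries.var R.rawRing
  a = PowerSeries.const R.rawRing y

  open BaseExpansion S q a using (monos; base^n-expansion)
  open Denominators S q a using (expansion; ÷-expansion; numerator-expansion)

  monos-homogeneous : ∀ (v : Vec ℕ n) j → j ≢ Vec.sum v → monos m v j R.≈ R.0#
  monos-homogeneous v j = Homogeneous.var^-const^-≢ R (Vec.sum v) y (Vec.sum (Vec.map (_% m) v)) j

  leftSide : ℕ → S.Carrier
  leftSide k = ([ suc k ] (q ^ₛ m) S.+ a S.* q S.* [ k ] (q ^ₛ m) S.* [ m ∸ 1 ] (a S.* q)) ^ₛ n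

  -- The common form to which the coefficient of t^k is brought on both sides.
  enumerator : ℕ → S.Carrier
  enumerator k = ∑ (monos m) (divisibleWords k)

  leftSide-∣ : ∀ k j → p ∣ j → leftSide k j R.≈ enumerator k j
  leftSide-∣ k j p∣j = R.trans (base^n-expansion m k n j)
    (Homogeneous.∑-filter-∣ R Vec.sum (monos m) monos-homogeneous p (tuples (downFrom (suc (k ℕ.* m))) n) j p∣j)

  leftSide-∤ : ∀ k j → ¬ p ∣ j → R.0# R.≈ enumerator k j
  leftSide-∤ k j p∤j = Homogeneous.∑-filter-∤ R Vec.sum (monos m) monos-homogeneous p
    (tuples (downFrom (suc (k ℕ.* m))) n) j p∤j

  weight : SubG r p n → T.Carrier
  weight x = var ^ₜ des (proj₁ x) T.* const q ^ₜ fmaj (proj₁ x) T.* const a ^ₜ col (proj₁ x)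
    where open RingOps T.rawRing using () renaming (_^_ to _^ₜ_)

  enumerator-÷ : ∀ {reps} → (∀ x → Any (x ∼_) reps) → AllPairs (λ x y → ¬ (x ∼ y)) reps → ∀ D →
    (let open RingOps T.rawRing in D ≈ product (λ i → 1# - var ^ tDegree i * const q ^ qDegree i)) →
    enumerator T.≈ List.foldr T._+_ T.0# (map weight reps) ÷ₜ D
  enumerator-÷ {reps} complete distinct D D≈ k = begin
    ∑ (monos m) (divisibleWords k)
      ≈⟨ ∑-↭ (monos m) (divisibleWords↭words {reps} complete distinct k) ⟩
    ∑ (monos m) (words reps k)
      ≈⟨ ∑-concatMap (monos m) (λ x → map (word x) (exponents k x)) reps ⟩
    ∑ (λ x → ∑ (monos m) (map (word x) (exponents k x))) reps
      ≈⟨ ∑-cong (λ x → S.trans (∑-map (monos m) (word x) (exponents k x)) (∑-cong (monos≡ x) (exponents k x))) reps ⟩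
    ∑ (λ x → ∑ (λ b → q ^ₛ (fmaj (proj₁ x) ℕ.+ dot qDegree b) S.* a ^ₛ col (proj₁ x)) (exponents k x)) reps
      ≈⟨ numerator-expansion tDegree qDegree (des ∘ proj₁) (fmaj ∘ proj₁) (col ∘ proj₁) reps k ⟨
    (N T.* expansion tDegree qDegree) k
      ≈⟨ ÷-expansion tDegree qDegree tDegree>0 N D D≈ k ⟩
    (N ÷ₜ D) k ∎
    where
    open SetoidReasoning S.setoid
    N = List.foldr T._+_ T.0# (map weight reps)
    monos≡ : ∀ x b → monos m (word x b) S.≈ q ^ₛ (fmaj (proj₁ x) ℕ.+ dot qDegree b) S.* a ^ₛ col (proj₁ x)
    monos≡ x b = S.reflexive (≡.cong₂ (λ i j → q ^ₛ i S.* a ^ₛ j) (sum-word x b) (sum-word-% x b))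

  Structure : Set _
  Structure = Σ[ raw ∈ RawRing c ℓ ] let X = RawRing.Carrier raw in X × X × X × (X → X → X) × X

  structure : Structure
  structure = PowerSeries.rawRing S.rawRing , var , const q , const a , _÷ₜ_ , enumerator

  -- Stated for a copy of the structure, so that at ℤ⟦t,q,a⟧ only the operations
  -- have to be compared with the generic ones: comparing the two sides of the
  -- formula directly would unfold nested products of series.
  enumerator-formula : ∀ ((raw , t , q , a , _/′_ , F) : Structure) → structure ≡ (raw , t , q , a , _/′_ , F) →
    let open RingOps raw in
    ∀ {reps} → (∀ x → Any (x ∼_) reps) → AllPairs (λ x y → ¬ (x ∼ y)) reps →
    F ≈ (List.foldr _+_ 0# (map (λ x → t ^ des (proj₁ x) * q ^ fmaj (proj₁ x) * a ^ col (proj₁ x)) reps)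
         /′ ((1# - t)
             * product {n ∸ 1} (λ i → 1# - t ^ s * q ^ (suc (toℕ i) ℕ.* r))
             * (1# - t * q ^ (n ℕ.* r / s))))
  enumerator-formula _ ≡.refl {reps} complete distinct = enumerator-÷ {reps} complete distinct _
    (DenominatorFactors.denominator-factors (SeriesRing.seriesRing S) var (const q) r p s n′ p∣r s∣r ps∣rn)

open import Data.Nat.Base using (_*_)

theorem5p2 : ∀ (r p s n : ℕ) .{{_ : NonZero r}} .{{_ : NonZero p}} .{{_ : NonZero s}} .{{_ : NonZero n}} →
    (p∣r : p ∣ r) (s∣r : s ∣ r) (ps∣rn : p * s ∣ r * n) →
    keepQ p (∑ₖtᵏ (λ k → base r s k ^qa n)) ≈tqa numerator r p s n s∣r ÷ denominator r s n
theorem5p2 r p s n@(suc n′) p∣r s∣r ps∣rn k j l = ≡.trans (kept k j l) (formula k j l)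
  where
  open BothSides (SeriesRing.seriesRing ℤₚ.+-*-commutativeRing) (PowerSeries.var ℤ.+-*-rawRing) r p s n′ p∣r s∣r ps∣rn
    using (leftSide-∣; leftSide-∤; enumerator; enumerator-formula)
  open Quotient r p s n s∣r using (elements; elements-complete; elements-unique)

  kept : keepQ p (∑ₖtᵏ (λ k → base r s k ^qa n)) ≈tqa enumerator
  -- The decision lets the conditional in `keepQ` compute, to the left side itself or to zero.
  kept k j l with p ∣? j
  ... | yes p∣j = leftSide-∣ k j p∣j l
  ... | no  p∤j = leftSide-∤ k j p∤j l

  formula : enumerator ≈tqa numerator r p s n s∣r ÷ denominator r s n
  formula = enumerator-formula (ℤ⟦t,q,a⟧ , RightSide.t , RightSide.q , RightSide.a , _÷_ , enumerator) ≡.refl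
    {elements} elements-complete elements-unique
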